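{- For every integer $m\ge 5$ and every edge probability measure $\mu$ on a finite complete graph $K$, \[ 2m\cdot\beta(\mu;C_m)+\beta(\mu;P_{m+1})\le\frac{2.6947}{m^{m-1}}. \]
   Context: $C_k$ is the cycle on $k$ vertices and $P_k$ is the path on $k$ vertices. An edge probability measure on $K$ is a probability measure on $E(K)$. For a subgraph $H'\subseteq K$, $\mu(H')=\prod_{e\in E(H')}\mu(e)$, and for a graph $H$, $\beta(\mu;H)=\sum_{H'}\mu(H')$, the sum over all (unlabeled, not necessarily induced) subgraphs $H'$ of $K$ isomorphic to $H$.
   Formalization: The edge probability measure is taken to have rational values; the inequality is stated multiplied through by the positive number m^(m-1). -}

module Defs where

open import Data.Bool using (Bool; true; false; not; if_then_else_; _∧_; _∨_)
open import Data.Nat as ℕ using (ℕ; zero; suc; _<ᵇ_; _≡ᵇ_)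
open import Data.Fin using (Fin; toℕ; fromℕ; inject₁) renaming (zero to fzero; suc to fsuc)
open import Data.List using (List; []; _∷_; map; concatMap; foldr; _++_)
open import Data.Bool.ListAction using (all; any)
open import Data.List.Base using (allFin)
open import Data.Vec using (Vec; lookup; toList) renaming ([] to []v; _∷_ to _∷v_)
open import Data.Product using (_×_; _,_)
open import Data.Integer using (+_)
open import Data.Rational using (ℚ; 0ℚ; 1ℚ; _+_; _*_; _/_) renaming (_≤_ to _≤ℚ_)
open import Relation.Binary.PropositionalEquality using (_≡_)

-- The complete graph K on vertex set Fin n.
-- An edge {i,j} of K is represented once, as the ordered pair (i , j)
-- with i < j.

_==_ : {n : ℕ} → Fin n → Fin n → Bool
a == b = toℕ a ≡ᵇ toℕ b

edgeList : (n : ℕ) → List (Fin n × Fin n)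
edgeList n =
  concatMap (λ i → concatMap (λ j → if toℕ i <ᵇ toℕ j then (i , j) ∷ [] else [])
                              (allFin n))
            (allFin n)

sameEdge : {n : ℕ} → Fin n × Fin n → Fin n × Fin n → Bool
sameEdge (a , b) (c , d) = ((a == c) ∧ (b == d)) ∨ ((a == d) ∧ (b == c))

memE : {n : ℕ} → Fin n × Fin n → List (Fin n × Fin n) → Bool
memE e S = any (sameEdge e) S

setEqE : {n : ℕ} → List (Fin n × Fin n) → List (Fin n × Fin n) → Bool
setEqE S T = all (λ e → memE e T) S ∧ all (λ e → memE e S) T

-- all subsets (as sublists) of a list; for a duplicate-free list each
-- subset occurs exactly once
sublists : {A : Set} → List A → List (List A)
sublists [] = [] ∷ []
sublists (x ∷ xs) = map (x ∷_) (sublists xs) ++ sublists xs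

subgraphs : (n : ℕ) → List (List (Fin n × Fin n))
subgraphs n = sublists (edgeList n)

-- Pattern graphs H: vertex set Fin k and a (duplicate-free) edge list.

record Graph : Set where
  constructor graph
  field
    vertices : ℕ
    edges    : List (Fin vertices × Fin vertices)
open Graph public

pathEdges : (k : ℕ) → List (Fin (suc k) × Fin (suc k))
pathEdges k = map (λ i → inject₁ i , fsuc i) (allFin k)

cycleEdges : (k : ℕ) → List (Fin (suc k) × Fin (suc k))
cycleEdges k = (fromℕ k , fzero) ∷ pathEdges k

-- C m : the cycle on m vertices (meaningful for m ≥ 3)
C : ℕ → Graph
C zero    = graph 0 []
C (suc k) = graph (suc k) (cycleEdges k)

P : ℕ → Graph
P zero    = graph 0 []
P (suc k) = graph (suc k) (pathEdges k)

allVecs : (k n : ℕ) → List (Vec (Fin n) k)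
allVecs zero    n = []v ∷ []
allVecs (suc k) n = concatMap (λ v → map (_∷v v) (allFin n)) (allVecs k n)

distinct : {n k : ℕ} → Vec (Fin n) k → Bool
distinct []v = true
distinct (x ∷v v) = all (λ y → not (x == y)) (toList v) ∧ distinct v

injections : (k n : ℕ) → List (Vec (Fin n) k)
injections k n = filterB distinct (allVecs k n)
  where
  filterB : {A : Set} → (A → Bool) → List A → List A
  filterB p [] = []
  filterB p (x ∷ xs) = if p x then x ∷ filterB p xs else filterB p xs

imageE : {k n : ℕ} → Vec (Fin n) k → List (Fin k × Fin k) → List (Fin n × Fin n)
imageE φ = map (λ { (a , b) → lookup φ a , lookup φ b })

-- A subgraph H' of K (without isolated vertices, given by its edge set S)
-- is isomorphic to H (without isolated vertices) iff some injection
-- φ : V(H) → V(K) maps E(H) onto S.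
isIsoTo : {n : ℕ} → Graph → List (Fin n × Fin n) → Bool
isIsoTo {n} H S = any (λ φ → setEqE (imageE φ (edges H)) S) (injections (vertices H) n)

-- Edge weights.  μ is given as a function on pairs; only the values
-- μ i j with i < j (i.e. the edges of K as listed in edgeList) are used.

sumℚ : List ℚ → ℚ
sumℚ = foldr _+_ 0ℚ

prodℚ : List ℚ → ℚ
prodℚ = foldr _*_ 1ℚ

weight : {n : ℕ} → (Fin n → Fin n → ℚ) → List (Fin n × Fin n) → ℚ
weight μ S = prodℚ (map (λ { (i , j) → μ i j }) S)

record IsEdgeProbabilityMeasure {n : ℕ} (μ : Fin n → Fin n → ℚ) : Set where
  field
    nonneg : ∀ (i j : Fin n) → toℕ i ℕ.< toℕ j → 0ℚ ≤ℚ μ i j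
    total  : sumℚ (map (λ { (i , j) → μ i j }) (edgeList n)) ≡ 1ℚ

-- β(μ;H) = Σ_{H' ⊆ K, H' ≅ H} μ(H')   (for H without isolated vertices)
β : {n : ℕ} → (Fin n → Fin n → ℚ) → Graph → ℚ
β {n} μ H = sumℚ (map (λ S → if isIsoTo H S then weight μ S else 0ℚ) (subgraphs n))

ℕtoℚ : ℕ → ℚ
ℕtoℚ m = + m / 1

{-# OPTIONS --safe #-}

-- After clearing denominators μ is a weight w : E(K) → ℕ of large total N, and the left hand side
-- is a squarefree form F of degree m in the weights. Hill climbing over the weights of total N
-- reaches a w that no shift of one unit from an edge to another improves; Euler's identity then
-- gives, for every edge f of positive weight, m F ≤ (N + m - 1) ∂F/∂f. Take for f = xy the heaviest
-- edge, of weight c. A path through f consists of two arms leaving x and y, of i and m - 1 - i edges,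
-- and a cycle through f splits into such arms for every i once its closing edge is removed, so
-- that ∂F/∂f is at most a sum of m terms 2 (cycles) + (paths with f at position i). Choosing the vertices
-- of the arms one at a time and taking the best neighbour each time bounds such a term by a
-- product of weights of edge-disjoint stars. For the last two steps, let t be the weight of the
-- penultimate star and Y the weight that is left over; they contribute at most 2cY and at
-- most t(Y + c). AM-GM with the first bound if t ≥ 3N/4m, and with the second one otherwise, gives
-- m^(m-1) (term) / N^(m-1) ≤ max (2 e^(1/4), (3/4) e^(5/4)) < 2.692.
module Submission where

open import Defs
open import Data.Nat using (ℕ; _≤_; _+_; _*_; _∸_; _^_)
open import Data.Fin using (Fin)
open import Data.Rational using (ℚ; _/_) renaming (_≤_ to _≤ℚ_; _+_ to _+ℚ_; _*_ to _*ℚ_)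

open import Data.Bool using (Bool; true; false; not; if_then_else_; _∧_; _∨_; T)
open import Data.Bool.ListAction using (all; any)
open import Data.Empty using (⊥-elim)
open import Data.Fin using (toℕ; inject₁; fromℕ)
import Data.Fin.Properties as Fin
open import Data.Integer as ℤ using ()
import Data.Integer.Properties as ℤ
open import Data.List using (List; []; _∷_; _++_; _∷ʳ_; length; replicate; map; concatMap; [_]; allFin; tabulate; upTo; initLast; _∷ʳ′_)
open import Data.List.Membership.Propositional using (_∈_; _∉_; find; lose)
open import Data.List.Membership.Propositional.Properties
  using (∈-map⁺; ∈-map⁻; ∈-concatMap⁺; ∈-concatMap⁻; ∈-∃++; ∈-++⁻; ∈-++⁺ˡ; ∈-++⁺ʳ; ∈-allFin; ∈-upTo⁺; ∈-upTo⁻)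
open import Data.List.Membership.Propositional.Properties.WithK using (unique∧set⇒bag)
open import Data.List.Properties using (length-replicate; length-++; length-upTo; map-tabulate; ++-assoc; ++-identityʳ)
open import Data.List.Relation.Binary.BagAndSetEquality using (∼bag⇒↭)
open import Data.List.Relation.Binary.Permutation.Propositional
  using (_↭_; prep; swap; ↭-refl; ↭-sym; ↭-trans; ↭-reflexive; ↭⇒↭ₛ; module PermutationReasoning)
open import Data.List.Relation.Binary.Permutation.Propositional.Properties as ↭
  using (∈-resp-↭; shift; ↭-length; ++-comm; ++⁺ˡ; ∷↭∷ʳ)
import Data.List.Relation.Binary.Permutation.Setoid.Properties as Setoid↭
open import Data.List.Relation.Unary.All as All using (All; []; _∷_)
import Data.List.Relation.Unary.All.Properties as All
open import Data.List.Relation.Unary.AllPairs as AllPairs using ([]; _∷_)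
import Data.List.Relation.Unary.AllPairs.Properties as AllPairs
open import Data.List.Relation.Unary.Any as Any using (here; there; any?)
open import Data.List.Relation.Unary.Unique.Propositional using (Unique)
import Data.List.Relation.Unary.Unique.Propositional.Properties as Unique
open import Data.Nat hiding (_≟_; _/_)
import Data.Nat as ℕ
import Data.Nat.Coprimality as Coprime
open import Data.Nat.Divisibility using (∣n⇒∣m*n)
open import Data.Nat.DivMod using (m/n*n≡m)
open import Data.Nat.ListAction using (sum; product)
open import Data.Nat.ListAction.Properties using (sum-++; product-++; product-↭; ∈⇒∣product; product≢0)
open import Data.Nat.Properties hiding (_≟_)
open import Data.Nat.Tactic.RingSolver using (solve-∀)
open import Data.Product as Product using (_×_; _,_; proj₁; proj₂; ∃; ∃₂; map₁; map₂)
open import Data.Product.Properties using (≡-dec)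
open import Data.Rational using (mkℚ; 0ℚ; 1ℚ; ↥_; ↧ₙ_; Positive; toℚᵘ; *≤*)
import Data.Rational.Properties as ℚ
open import Data.Rational.Properties using (↥p/↧p≡p; toℚᵘ-injective; toℚᵘ-homo-*)
open import Data.Rational.Solver using (module +-*-Solver)
open import Data.Rational.Unnormalised as ℚᵘ using (mkℚᵘ; *≡*)
import Data.Rational.Unnormalised.Properties as ℚᵘ
open import Data.Sum using (_⊎_; inj₁; inj₂)
open import Data.Unit using (tt)
open import Data.Vec using (Vec; lookup; toList) renaming ([] to []v; _∷_ to _∷v_)
open import Data.Vec.Properties using (length-toList)
open import Function using (_∘_; id; mk⇔)
open import Relation.Binary.Definitions using (DecidableEquality; tri<; tri≈; tri>)
open import Relation.Binary.PropositionalEquality hiding ([_])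
open import Relation.Nullary using (¬_; yes; no; does)
open import Relation.Nullary.Decidable using (_×-dec_)

-- The AM-GM inequality and the numerical estimates

-- A maximiser among the measures themselves would call for a compactness argument that rational
-- weights do not offer. Integer weights of fixed total are finite in number, so hill climbing ends.
-- The price is the error m - 1 in the Lagrange condition. As the common denominator may be
-- multiplied by any factor, N ≥ 1000 m can be arranged; the loss is then a factor 1.001, which fits
-- between 2.692 and 2.6947. Applied to the second bound alone, AM-GM has m - 1 factors of sum at
-- most N and gives (m/(m-1))^(m-1), which tends to e > 2.6947. The case split beats this. At t =
-- τN/m the second bound gives about τ e^(2-τ), and the first, whose factors share only N - t, gives
-- about 2 e^(1-τ). The two agree at τ = 2/e, and 3/4 is a simple fraction near it. The edge f is
-- the heaviest one because its weight c lies outside all the stars and yet dominates every other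
-- edge: in the first bound it stands in for the penultimate edge, in the second for one of the two
-- copies of the edge that closes a cycle.

2ab≤a²+b² : ∀ a b → 2 * (a * b) ≤ a * a + b * b
2ab≤a²+b² zero b = z≤n
2ab≤a²+b² (suc a) zero rewrite *-zeroʳ a = z≤n
2ab≤a²+b² (suc a) (suc b) = begin
  2 * (suc a * suc b)                         ≡⟨ lem₁ a b ⟩
  2 * (a * b) + (2 * a + 2 * b + 2)           ≤⟨ +-monoˡ-≤ _ (2ab≤a²+b² a b) ⟩
  a * a + b * b + (2 * a + 2 * b + 2)         ≡⟨ lem₂ a b ⟩
  suc a * suc a + suc b * suc b ∎
  where
  open ≤-Reasoning
  lem₁ : ∀ a b → 2 * (suc a * suc b) ≡ 2 * (a * b) + (2 * a + 2 * b + 2)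
  lem₁ = solve-∀
  lem₂ : ∀ a b → a * a + b * b + (2 * a + 2 * b + 2) ≡ suc a * suc a + suc b * suc b
  lem₂ = solve-∀

-- AM-GM for one `a` and `n` copies of `b`, without roots. The inductive step adds `a` times the
-- hypothesis to (n+1) b^n times 2ab ≤ a² + b²; the terms common to both sides are the ones
-- cancelled at the start.
young : ∀ n a b → suc n * (a * b ^ n) ≤ a ^ suc n + n * b ^ suc n
young zero a b = ≤-refl
young (suc n) a b = +-cancelˡ-≤ (suc n * (a * a * b ^ n) + n * (a * (b * b ^ n))) _ _ (begin
  suc n * (a * a * b ^ n) + n * (a * (b * b ^ n)) + suc (suc n) * (a * (b * b ^ n))
    ≡⟨ lem₁ n a b (b ^ n) ⟩
  a * (suc n * (a * b ^ n)) + suc n * b ^ n * (2 * (a * b))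
    ≤⟨ +-mono-≤ (*-monoʳ-≤ a (young n a b)) (*-monoʳ-≤ (suc n * b ^ n) (2ab≤a²+b² a b)) ⟩
  a * (a * a ^ n + n * (b * b ^ n)) + suc n * b ^ n * (a * a + b * b)
    ≡⟨ lem₂ n a b (a ^ n) (b ^ n) ⟩
  suc n * (a * a * b ^ n) + n * (a * (b * b ^ n)) + (a * (a * a ^ n) + suc n * (b * (b * b ^ n))) ∎)
  where
  open ≤-Reasoning
  lem₁ : ∀ n a b q → suc n * (a * a * q) + n * (a * (b * q)) + suc (suc n) * (a * (b * q))
                   ≡ a * (suc n * (a * q)) + suc n * q * (2 * (a * b))
  lem₁ = solve-∀
  lem₂ : ∀ n a b p q → a * (a * p + n * (b * q)) + suc n * q * (a * a + b * b)
       ≡ suc n * (a * a * q) + n * (a * (b * q)) + (a * (a * p) + suc n * (b * (b * q)))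
  lem₂ = solve-∀

^-distribˡ-* : ∀ k a b → (a * b) ^ k ≡ a ^ k * b ^ k
^-distribˡ-* zero a b = refl
^-distribˡ-* (suc k) a b = trans (cong (a * b *_) (^-distribˡ-* k a b)) (lem a b (a ^ k) (b ^ k))
  where
  lem : ∀ a b x y → a * b * (x * y) ≡ a * x * (b * y)
  lem = solve-∀

^-self-nonZero : ∀ k → NonZero (k ^ k)
^-self-nonZero zero = _
^-self-nonZero (suc k) = m^n≢0 (suc k) (suc k)

-- Here `y` plays the sum of `r` numbers. Young's inequality is applied to (t+y) r and y (r+1),
-- which coincide exactly at the optimum y = r t. The case r = 0 is separate because a factor `r` is
-- cancelled.
am-gm-step : ∀ r t y → t * y ^ r * suc r ^ suc r ≤ (t + y) ^ suc r * r ^ r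
am-gm-step zero t y = ≤-trans (≤-reflexive (lem t)) (≤-trans (m≤m+n t y) (≤-reflexive (lem′ t y)))
  where
  lem : ∀ t → t * 1 * (1 * 1) ≡ t
  lem = solve-∀
  lem′ : ∀ t y → t + y ≡ (t + y) * 1 * 1
  lem′ = solve-∀
am-gm-step r@(suc r′) t y = *-cancelʳ-≤ _ _ r (+-cancelʳ-≤ (suc r ^ suc r * r * (y * y ^ r)) _ _ (begin
  t * y ^ r * suc r ^ suc r * r + suc r ^ suc r * r * (y * y ^ r)
    ≡⟨ lem₁ r t y (y ^ r) (suc r ^ r) ⟩
  suc r * ((t + y) * r * (y ^ r * suc r ^ r))
    ≡⟨ cong (λ z → suc r * ((t + y) * r * z)) (sym (^-distribˡ-* r y (suc r))) ⟩
  suc r * ((t + y) * r * (y * suc r) ^ r)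
    ≤⟨ young r ((t + y) * r) (y * suc r) ⟩
  ((t + y) * r) ^ suc r + r * (y * suc r) ^ suc r
    ≡⟨ cong₂ (λ u v → u + r * v) (^-distribˡ-* (suc r) (t + y) r) (^-distribˡ-* (suc r) y (suc r)) ⟩
  (t + y) ^ suc r * r ^ suc r + r * (y ^ suc r * suc r ^ suc r)
    ≡⟨ lem₂ r y ((t + y) ^ suc r) (r ^ r) (y ^ r) (suc r ^ suc r) ⟩
  (t + y) ^ suc r * r ^ r * r + suc r ^ suc r * r * (y * y ^ r) ∎))
  where
  open ≤-Reasoning
  lem₁ : ∀ r t y p q → t * p * (suc r * q) * r + suc r * q * r * (y * p) ≡ suc r * ((t + y) * r * (p * q))
  lem₁ = solve-∀
  lem₂ : ∀ r y a b c d → a * (r * b) + r * (y * c * d) ≡ a * b * r + d * r * (y * c)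
  lem₂ = solve-∀

am-gm : ∀ xs → product xs * length xs ^ length xs ≤ sum xs ^ length xs
am-gm [] = ≤-refl
am-gm (x ∷ xs) = *-cancelʳ-≤ _ _ (r ^ r) {{^-self-nonZero r}} (begin
  x * product xs * suc r ^ suc r * r ^ r     ≡⟨ lem x (product xs) (suc r ^ suc r) (r ^ r) ⟩
  x * (product xs * r ^ r) * suc r ^ suc r   ≤⟨ *-monoˡ-≤ (suc r ^ suc r) (*-monoʳ-≤ x (am-gm xs)) ⟩
  x * sum xs ^ r * suc r ^ suc r             ≤⟨ am-gm-step r x (sum xs) ⟩
  (x + sum xs) ^ suc r * r ^ r ∎)
  where
  open ≤-Reasoning
  r = length xs
  lem : ∀ x p a b → x * p * a * b ≡ x * (p * b) * a
  lem = solve-∀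

sum-replicate : ∀ k x → sum (replicate k x) ≡ k * x
sum-replicate zero x = refl
sum-replicate (suc k) x = cong (x +_) (sum-replicate k x)

product-replicate : ∀ k x → product (replicate k x) ≡ x ^ k
product-replicate zero x = refl
product-replicate (suc k) x = cong (x *_) (product-replicate k x)

-- (1 + y/dk)^k ≤ (1 - y/dM)^(-M): AM-GM for k factors 1 + y/dk and M factors 1 - y/dM = c/dM.
exp-bound : ∀ {d y c k M} → .{{NonZero M}} → y + c ≡ d * M →
            (d * k + y) ^ k * c ^ M ≤ (d * k) ^ k * (d * M) ^ M
exp-bound {d} {y} {c} {zero} {M} y+c≡dM =
  *-monoʳ-≤ 1 (^-monoˡ-≤ M (≤-trans (m≤n+m c y) (≤-reflexive y+c≡dM)))
exp-bound {d} {y} {c} {k@(suc _)} {M} y+c≡dM =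
  *-cancelʳ-≤ _ _ (M ^ k * (k ^ M * l ^ l)) {{m*n≢0 _ _ {{m^n≢0 M k}} {{m*n≢0 _ _ {{m^n≢0 k M}} {{^-self-nonZero l}}}}}} (begin
  (d * k + y) ^ k * c ^ M * (M ^ k * (k ^ M * l ^ l))
    ≡⟨ rearrange ((d * k + y) ^ k) (c ^ M) (M ^ k) (k ^ M) (l ^ l) ⟩
  (M ^ k * (d * k + y) ^ k) * (k ^ M * c ^ M) * l ^ l
    ≡⟨ cong₂ (λ u v → u * v * l ^ l) (^-distribˡ-* k M (d * k + y)) (^-distribˡ-* M k c) ⟨
  (M * (d * k + y)) ^ k * (k * c) ^ M * l ^ l
    ≡⟨ cong₂ (λ u v → u * v * l ^ l) (product-replicate k (M * (d * k + y))) (product-replicate M (k * c)) ⟨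
  product xs * product ys * l ^ l
    ≡⟨ cong₂ (λ u v → u * v ^ v) (product-++ xs ys) len ⟨
  product (xs ++ ys) * length (xs ++ ys) ^ length (xs ++ ys)
    ≤⟨ am-gm (xs ++ ys) ⟩
  sum (xs ++ ys) ^ length (xs ++ ys)
    ≡⟨ cong₂ _^_ (trans (sum-++ xs ys) (cong₂ _+_ (sum-replicate k (M * (d * k + y))) (sum-replicate M (k * c)))) len ⟩
  (k * (M * (d * k + y)) + M * (k * c)) ^ l
    ≡⟨ cong (_^ l) (trans (collect d k M y c)
         (trans (cong (λ z → k * M * (d * k + z)) y+c≡dM) (factor d k M))) ⟩
  (M * (d * k) * l) ^ l
    ≡⟨ ^-distribˡ-* l (M * (d * k)) l ⟩
  (M * (d * k)) ^ l * l ^ l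
    ≡⟨ cong (_* l ^ l) (^-distribˡ-+-* (M * (d * k)) k M) ⟩
  (M * (d * k)) ^ k * (M * (d * k)) ^ M * l ^ l
    ≡⟨ cong₂ (λ u v → u * v * l ^ l) (^-distribˡ-* k M (d * k))
         (trans (cong (_^ M) (exchange d k M)) (^-distribˡ-* M k (d * M))) ⟩
  M ^ k * (d * k) ^ k * (k ^ M * (d * M) ^ M) * l ^ l
    ≡⟨ rearrange ((d * k) ^ k) ((d * M) ^ M) (M ^ k) (k ^ M) (l ^ l) ⟨
  (d * k) ^ k * (d * M) ^ M * (M ^ k * (k ^ M * l ^ l)) ∎)
  where
  open ≤-Reasoning
  l = k + M
  xs = replicate k (M * (d * k + y))
  ys = replicate M (k * c)
  len : length (xs ++ ys) ≡ l
  len = trans (length-++ xs) (cong₂ _+_ (length-replicate k) (length-replicate M))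
  rearrange : ∀ p q a b c → p * q * (a * (b * c)) ≡ a * p * (b * q) * c
  rearrange = solve-∀
  collect : ∀ d k M y c → k * (M * (d * k + y)) + M * (k * c) ≡ k * M * (d * k + (y + c))
  collect = solve-∀
  factor : ∀ d k M → k * M * (d * k + d * M) ≡ (M * (d * k)) * (k + M)
  factor = solve-∀
  exchange : ∀ d k M → M * (d * k) ≡ k * (d * M)
  exchange = solve-∀

-- The `r` factors share only N - t ≤ (4r+1)N/4m, so AM-GM gives 2 (1 + 1/4r)^r. By `exp-bound` with
-- M = 1 this is at most 2/(1 - 1/4) = 8/3 < 2.692.
large-star-bound : ∀ {r X N t} xs → .{{NonZero r}} → length xs ≡ r → X ≤ 2 * product xs → sum xs + t ≤ N →
                   3 * N ≤ 4 * suc r * t → X * suc r ^ r * 1000 ≤ 2692 * N ^ r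
large-star-bound {r} {X} {N} {t} xs refl X≤ sum+t≤N 3N≤4mt =
  *-cancelˡ-≤ 3 (begin
    3 * (X * m ^ r * 1000)  ≡⟨ shuffle X (m ^ r) ⟩
    3 * X * m ^ r * 1000    ≤⟨ *-monoˡ-≤ 1000 step ⟩
    8 * N ^ r * 1000        ≡⟨ shuffle′ (N ^ r) ⟩
    8000 * N ^ r            ≤⟨ *-monoˡ-≤ (N ^ r) (≤ᵇ⇒≤ 8000 8076 _) ⟩
    8076 * N ^ r            ≡⟨ *-assoc 3 2692 (N ^ r) ⟩
    3 * (2692 * N ^ r) ∎)
  where
  open ≤-Reasoning
  m = suc r
  A = sum xs
  shuffle : ∀ X a → 3 * (X * a * 1000) ≡ 3 * X * a * 1000
  shuffle = solve-∀
  shuffle′ : ∀ a → 8 * a * 1000 ≡ 8000 * a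
  shuffle′ = solve-∀
  A-bound : A * (4 * m) ≤ (4 * r + 1) * N
  A-bound = +-cancelʳ-≤ (3 * N) _ _ (begin
    A * (4 * m) + 3 * N        ≤⟨ +-monoʳ-≤ (A * (4 * m)) 3N≤4mt ⟩
    A * (4 * m) + 4 * m * t    ≡⟨ lem₁ A m t ⟩
    4 * m * (A + t)            ≤⟨ *-monoʳ-≤ (4 * m) sum+t≤N ⟩
    4 * m * N                  ≡⟨ lem₂ r N ⟩
    (4 * r + 1) * N + 3 * N ∎)
    where
    lem₁ : ∀ A m t → A * (4 * m) + 4 * m * t ≡ 4 * m * (A + t)
    lem₁ = solve-∀
    lem₂ : ∀ r N → 4 * suc r * N ≡ (4 * r + 1) * N + 3 * N
    lem₂ = solve-∀
  step : 3 * X * m ^ r ≤ 8 * N ^ r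
  step = *-cancelʳ-≤ _ _ (4 ^ r * r ^ r) {{m*n≢0 _ _ {{m^n≢0 4 r}} {{^-self-nonZero r}}}} (begin
    3 * X * m ^ r * (4 ^ r * r ^ r)                  ≤⟨ *-monoˡ-≤ (4 ^ r * r ^ r) (*-monoˡ-≤ (m ^ r) (*-monoʳ-≤ 3 X≤)) ⟩
    3 * (2 * product xs) * m ^ r * (4 ^ r * r ^ r)   ≡⟨ lem₁ (product xs) (m ^ r) (4 ^ r) (r ^ r) ⟩
    6 * (product xs * r ^ r * (4 ^ r * m ^ r))       ≡⟨ cong (λ z → 6 * (product xs * r ^ r * z)) (^-distribˡ-* r 4 m) ⟨
    6 * (product xs * r ^ r * (4 * m) ^ r)           ≤⟨ *-monoʳ-≤ 6 (*-monoˡ-≤ ((4 * m) ^ r) (am-gm xs)) ⟩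
    6 * (A ^ r * (4 * m) ^ r)                        ≡⟨ cong (6 *_) (^-distribˡ-* r A (4 * m)) ⟨
    6 * (A * (4 * m)) ^ r                            ≤⟨ *-monoʳ-≤ 6 (^-monoˡ-≤ r A-bound) ⟩
    6 * ((4 * r + 1) * N) ^ r                        ≡⟨ cong (6 *_) (^-distribˡ-* r (4 * r + 1) N) ⟩
    6 * ((4 * r + 1) ^ r * N ^ r)                    ≡⟨ lem₂ ((4 * r + 1) ^ r) (N ^ r) ⟩
    2 * ((4 * r + 1) ^ r * 3 ^ 1) * N ^ r            ≤⟨ *-monoˡ-≤ (N ^ r) (*-monoʳ-≤ 2 (exp-bound {4} {1} {3} {r} {1} refl)) ⟩
    2 * ((4 * r) ^ r * 4 ^ 1) * N ^ r                ≡⟨ cong (λ z → 2 * (z * 4 ^ 1) * N ^ r) (^-distribˡ-* r 4 r) ⟩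
    2 * (4 ^ r * r ^ r * 4 ^ 1) * N ^ r              ≡⟨ lem₃ (4 ^ r) (r ^ r) (N ^ r) ⟩
    8 * N ^ r * (4 ^ r * r ^ r) ∎)
    where
    lem₁ : ∀ p a b c → 3 * (2 * p) * a * (b * c) ≡ 6 * (p * c * (b * a))
    lem₁ = solve-∀
    lem₂ : ∀ a b → 6 * (a * b) ≡ 2 * (a * 3) * b
    lem₂ = solve-∀
    lem₃ : ∀ a b c → 2 * (a * b * 4) * c ≡ 8 * c * (a * b)
    lem₃ = solve-∀

-- Equal stars are best, so `product xs` becomes A^q up to the factor q^q. Subject to A + t ≤ N, the
-- product t A^q is largest at the cap t = 3N/4m and gives (3/4)(1 + 5/4q)^q. `exp-bound` with M =
-- 30 replaces this by (3/4)(120/115)^30, about 2.689; M has to be large enough for this to stay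
-- below 2.692.
small-star-bound : ∀ {q X N t} xs → .{{NonZero q}} → length xs ≡ q → X ≤ t * product xs → sum xs + t ≤ N →
                   4 * suc (suc q) * t ≤ 3 * N → X * suc (suc q) ^ suc q * 1000 ≤ 2692 * N ^ suc q
small-star-bound {q} {X} {N} {t} xs refl X≤ sum+t≤N 4mt≤3N =
  *-cancelʳ-≤ _ _ (4 * 115 ^ 30) (begin
    X * m ^ suc q * 1000 * (4 * E)          ≡⟨ lem₁ X (m ^ suc q) E ⟩
    (4 * (X * m ^ suc q * E)) * 1000        ≤⟨ *-monoˡ-≤ 1000 step ⟩
    3 * (N ^ suc q * E′) * 1000             ≡⟨ lem₂ (N ^ suc q) E′ ⟩
    3000 * E′ * N ^ suc q                   ≤⟨ *-monoˡ-≤ (N ^ suc q) (≤ᵇ⇒≤ (3000 * 120 ^ 30) (2692 * (4 * 115 ^ 30)) _) ⟩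
    2692 * (4 * E) * N ^ suc q              ≡⟨ lem₃ (N ^ suc q) E 2692 ⟩
    2692 * N ^ suc q * (4 * E) ∎)
  where
  open ≤-Reasoning
  m = suc (suc q)
  A = sum xs
  E E′ : ℕ
  E = 115 ^ 30
  E′ = 120 ^ 30
  lem₁ : ∀ X a e → X * a * 1000 * (4 * e) ≡ (4 * (X * a * e)) * 1000
  lem₁ = solve-∀
  lem₂ : ∀ a e → 3 * (a * e) * 1000 ≡ 3000 * e * a
  lem₂ = solve-∀
  lem₃ : ∀ a e c → c * (4 * e) * a ≡ c * a * (4 * e)
  lem₃ = solve-∀
  -- At the extreme point t = 3N/4m and A = (4q+5)N/4m, hence c t = 3A: all entries of `ys` agree
  -- there and AM-GM is sharp.
  c = 4 * q + 5
  ys = c * t ∷ replicate q (3 * A)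
  ys-sum : sum ys * (4 * m) ≤ 3 * N * c * suc q
  ys-sum = begin
    sum ys * (4 * m)                                 ≡⟨ cong (λ z → (c * t + z) * (4 * m)) (sum-replicate q (3 * A)) ⟩
    (c * t + q * (3 * A)) * (4 * m)                  ≡⟨ lem₁′ q t A ⟩
    12 * q * m * (A + t) + (q + 5) * (4 * m * t)     ≤⟨ +-mono-≤ (*-monoʳ-≤ (12 * q * m) sum+t≤N) (*-monoʳ-≤ (q + 5) 4mt≤3N) ⟩
    12 * q * m * N + (q + 5) * (3 * N)               ≡⟨ lem₂′ q N ⟩
    3 * N * c * suc q ∎
    where
    lem₁′ : ∀ q t A → ((4 * q + 5) * t + q * (3 * A)) * (4 * suc (suc q))
                    ≡ 12 * q * suc (suc q) * (A + t) + (q + 5) * (4 * suc (suc q) * t)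
    lem₁′ = solve-∀
    lem₂′ : ∀ q N → 12 * q * suc (suc q) * N + (q + 5) * (3 * N) ≡ 3 * N * (4 * q + 5) * suc q
    lem₂′ = solve-∀
  tA-bound : t * A ^ q * (4 * m) ^ suc q ≤ 3 * N ^ suc q * c ^ q
  tA-bound = *-cancelʳ-≤ _ _ (c * 3 ^ q * suc q ^ suc q)
    {{m*n≢0 _ _ {{m*n≢0 c _ {{c≢0}} {{m^n≢0 3 q}}}} {{^-self-nonZero (suc q)}}}} (begin
    t * A ^ q * (4 * m) ^ suc q * (c * 3 ^ q * suc q ^ suc q)
      ≡⟨ lem₁′ t (A ^ q) ((4 * m) ^ suc q) c (3 ^ q) (suc q ^ suc q) ⟩
    c * t * (3 ^ q * A ^ q) * suc q ^ suc q * (4 * m) ^ suc q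
      ≡⟨ cong (λ z → c * t * z * suc q ^ suc q * (4 * m) ^ suc q) (trans (product-replicate q (3 * A)) (^-distribˡ-* q 3 A)) ⟨
    product ys * suc q ^ suc q * (4 * m) ^ suc q
      ≡⟨ cong (λ z → product ys * suc z ^ suc z * (4 * m) ^ suc q) (length-replicate q) ⟨
    product ys * length ys ^ length ys * (4 * m) ^ suc q
      ≤⟨ *-monoˡ-≤ ((4 * m) ^ suc q) (am-gm ys) ⟩
    sum ys ^ length ys * (4 * m) ^ suc q
      ≡⟨ cong (λ z → sum ys ^ suc z * (4 * m) ^ suc q) (length-replicate q) ⟩
    sum ys ^ suc q * (4 * m) ^ suc q
      ≡⟨ ^-distribˡ-* (suc q) (sum ys) (4 * m) ⟨
    (sum ys * (4 * m)) ^ suc q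
      ≤⟨ ^-monoˡ-≤ (suc q) ys-sum ⟩
    (3 * N * c * suc q) ^ suc q
      ≡⟨ ^-distribˡ-* (suc q) (3 * N * c) (suc q) ⟩
    (3 * N * c) ^ suc q * suc q ^ suc q
      ≡⟨ cong (_* suc q ^ suc q) (trans (^-distribˡ-* (suc q) (3 * N) c) (cong (_* c ^ suc q) (^-distribˡ-* (suc q) 3 N))) ⟩
    3 ^ suc q * N ^ suc q * c ^ suc q * suc q ^ suc q
      ≡⟨ lem₂′ (3 ^ q) (N ^ suc q) c (c ^ q) (suc q ^ suc q) ⟩
    3 * N ^ suc q * c ^ q * (c * 3 ^ q * suc q ^ suc q) ∎)
    where
    c≢0 : NonZero c
    c≢0 = >-nonZero (≤-trans (s≤s z≤n) (m≤n+m 5 (4 * q)))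
    lem₁′ : ∀ t a b c p s → t * a * b * (c * p * s) ≡ c * t * (p * a) * s * b
    lem₁′ = solve-∀
    lem₂′ : ∀ p n c d s → 3 * p * n * (c * d) * s ≡ 3 * n * d * (c * p * s)
    lem₂′ = solve-∀
  step : 4 * (X * m ^ suc q * E) ≤ 3 * (N ^ suc q * E′)
  step = *-cancelʳ-≤ _ _ (4 ^ q * q ^ q) {{m*n≢0 _ _ {{m^n≢0 4 q}} {{^-self-nonZero q}}}} (begin
    4 * (X * m ^ suc q * E) * (4 ^ q * q ^ q)          ≡⟨ lem₁′ X (m ^ suc q) E (4 ^ q) (q ^ q) ⟩
    X * q ^ q * (4 * 4 ^ q * m ^ suc q) * E            ≡⟨ cong (λ z → X * q ^ q * z * E) (^-distribˡ-* (suc q) 4 m) ⟨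
    X * q ^ q * (4 * m) ^ suc q * E                    ≤⟨ *-monoˡ-≤ E (*-monoˡ-≤ ((4 * m) ^ suc q) (*-monoˡ-≤ (q ^ q) X≤)) ⟩
    t * product xs * q ^ q * (4 * m) ^ suc q * E       ≡⟨ cong (λ z → z * (4 * m) ^ suc q * E) (*-assoc t (product xs) (q ^ q)) ⟩
    t * (product xs * q ^ q) * (4 * m) ^ suc q * E     ≤⟨ *-monoˡ-≤ E (*-monoˡ-≤ ((4 * m) ^ suc q) (*-monoʳ-≤ t (am-gm xs))) ⟩
    t * A ^ q * (4 * m) ^ suc q * E                    ≤⟨ *-monoˡ-≤ E tA-bound ⟩
    3 * N ^ suc q * c ^ q * E                          ≡⟨ lem₂′ (N ^ suc q) (c ^ q) E ⟩
    3 * N ^ suc q * (c ^ q * E)                        ≤⟨ *-monoʳ-≤ (3 * N ^ suc q) (exp-bound {4} {5} {115} {q} {30} refl) ⟩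
    3 * N ^ suc q * ((4 * q) ^ q * E′)                 ≡⟨ cong (λ z → 3 * N ^ suc q * (z * E′)) (^-distribˡ-* q 4 q) ⟩
    3 * N ^ suc q * (4 ^ q * q ^ q * E′)               ≡⟨ lem₃′ (N ^ suc q) (4 ^ q * q ^ q) E′ ⟩
    3 * (N ^ suc q * E′) * (4 ^ q * q ^ q) ∎)
    where
    lem₁′ : ∀ X a e f g → 4 * (X * a * e) * (f * g) ≡ X * g * (4 * f * a) * e
    lem₁′ = solve-∀
    lem₂′ : ∀ n a e → 3 * n * a * e ≡ 3 * n * (a * e)
    lem₂′ = solve-∀
    lem₃′ : ∀ n a e → 3 * n * (a * e) ≡ 3 * (n * e) * a
    lem₃′ = solve-∀

-- Multiplies the Lagrange condition, the derivative bound with constant b/a and the discretisation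
-- loss c/a. The constants are variables so that the ring identities contain no large numerals.
optimum-combine : ∀ a b c d e s {m V M D t N K} → .{{NonZero m}} → .{{NonZero e}} →
  m * V ≤ (t + m) * D → D * M * a ≤ m * (b * K) → a * (t + m) ≤ c * N → c * b ≤ e * d → s * e ≡ a * a →
  V * M * s ≤ d * (N * K)
optimum-combine a b c d e s {m} {V} {M} {D} {t} {N} {K} mV≤ DM≤ tm≤ cb≤ se≡ = *-cancelˡ-≤ e (*-cancelˡ-≤ m (begin
  m * (e * (V * M * s))               ≡⟨ lem₁ m e V M s ⟩
  m * V * M * (s * e)                 ≡⟨ cong (m * V * M *_) se≡ ⟩
  m * V * M * (a * a)                 ≤⟨ *-monoˡ-≤ (a * a) (*-monoˡ-≤ M mV≤) ⟩
  (t + m) * D * M * (a * a)           ≡⟨ lem₂ (t + m) D M a ⟩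
  a * (t + m) * (D * M * a)           ≤⟨ *-mono-≤ tm≤ DM≤ ⟩
  c * N * (m * (b * K))               ≡⟨ lem₃ c N m b K ⟩
  c * b * (m * (N * K))               ≤⟨ *-monoˡ-≤ (m * (N * K)) cb≤ ⟩
  e * d * (m * (N * K))               ≡⟨ lem₄ e d m (N * K) ⟩
  m * (e * (d * (N * K))) ∎))
  where
  open ≤-Reasoning
  lem₁ : ∀ m e V M s → m * (e * (V * M * s)) ≡ m * V * M * (s * e)
  lem₁ = solve-∀
  lem₂ : ∀ a b c k → a * b * c * (k * k) ≡ k * a * (b * c * k)
  lem₂ = solve-∀
  lem₃ : ∀ a N m b k → a * N * (m * (b * k)) ≡ a * b * (m * (N * k))
  lem₃ = solve-∀
  lem₄ : ∀ a b m k → a * b * (m * k) ≡ m * (a * (b * k))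
  lem₄ = solve-∀

optimum-arithmetic : ∀ m V M D t N K {d} → .{{NonZero m}} → d ≡ 26947 →
  m * V ≤ (t + m) * D → D * M * 1000 ≤ m * (2692 * K) → 1000 * (t + m) ≤ 1001 * N → V * M * 10000 ≤ d * (N * K)
optimum-arithmetic m V M D t N K refl p q r =
  -- 1001 · 2692 = 2694692 ≤ 2694700, that is, 1.001 · 2.692 ≤ 2.6947.
  optimum-combine 1000 2692 1001 26947 100 10000 {m} {V} {M} {D} {t} {N} {K} p q r (≤ᵇ⇒≤ (1001 * 2692) (100 * 26947) _) refl

-- Greedy bounds for sums over paths

∑ : {A : Set} → List A → (A → ℕ) → ℕ
∑ [] f = 0
∑ (x ∷ xs) f = f x + ∑ xs f

module _ {A : Set} where

  ∑-mono : ∀ (xs : List A) {f g} → (∀ {x} → x ∈ xs → f x ≤ g x) → ∑ xs f ≤ ∑ xs g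
  ∑-mono [] f≤g = z≤n
  ∑-mono (x ∷ xs) f≤g = +-mono-≤ (f≤g (here refl)) (∑-mono xs (f≤g ∘ there))

  ∑-cong : ∀ (xs : List A) {f g} → (∀ {x} → x ∈ xs → f x ≡ g x) → ∑ xs f ≡ ∑ xs g
  ∑-cong [] f≡g = refl
  ∑-cong (x ∷ xs) f≡g = cong₂ _+_ (f≡g (here refl)) (∑-cong xs (f≡g ∘ there))

  ∑-+ : ∀ (xs : List A) (f g : A → ℕ) → ∑ xs (λ x → f x + g x) ≡ ∑ xs f + ∑ xs g
  ∑-+ [] f g = refl
  ∑-+ (x ∷ xs) f g = trans (cong (f x + g x +_) (∑-+ xs f g)) (interchange (f x) (g x) (∑ xs f) (∑ xs g))
    where
    interchange : ∀ a b c d → a + b + (c + d) ≡ a + c + (b + d)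
    interchange = solve-∀

  ∑-*ˡ : ∀ (xs : List A) c f → ∑ xs (λ x → c * f x) ≡ c * ∑ xs f
  ∑-*ˡ [] c f = sym (*-zeroʳ c)
  ∑-*ˡ (x ∷ xs) c f = trans (cong (c * f x +_) (∑-*ˡ xs c f)) (sym (*-distribˡ-+ c (f x) (∑ xs f)))

  ∑-*ʳ : ∀ (xs : List A) c f → ∑ xs (λ x → f x * c) ≡ ∑ xs f * c
  ∑-*ʳ [] c f = refl
  ∑-*ʳ (x ∷ xs) c f = trans (cong (f x * c +_) (∑-*ʳ xs c f)) (sym (*-distribʳ-+ c (f x) (∑ xs f)))

  ∑-++ : ∀ (xs ys : List A) f → ∑ (xs ++ ys) f ≡ ∑ xs f + ∑ ys f
  ∑-++ [] ys f = refl
  ∑-++ (x ∷ xs) ys f = trans (cong (f x +_) (∑-++ xs ys f)) (sym (+-assoc (f x) _ _))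

  -- Averaging: the element with the largest `g` may carry the whole weight. The empty list has no
  -- such element and is reported separately; it becomes the dead end in `greedy`.
  ∑-weighted-max : ∀ (xs : List A) (a g : A → ℕ) → xs ≡ [] ⊎ ∃ λ x → x ∈ xs × ∑ xs (λ y → a y * g y) ≤ ∑ xs a * g x
  ∑-weighted-max [] a g = inj₁ refl
  ∑-weighted-max (x ∷ xs) a g with ∑-weighted-max xs a g
  ... | inj₁ refl = inj₂ (x , here refl , ≤-reflexive (trans (+-identityʳ _) (cong (_* g x) (sym (+-identityʳ (a x))))))
  ... | inj₂ (y , y∈xs , le) with ≤-total (g x) (g y)
  ...   | inj₁ gx≤gy = inj₂ (y , there y∈xs , ≤-trans (+-mono-≤ (*-monoʳ-≤ (a x) gx≤gy) le)
                                                (≤-reflexive (sym (*-distribʳ-+ (g y) (a x) (∑ xs a)))))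
  ...   | inj₂ gy≤gx = inj₂ (x , here refl , ≤-trans (+-monoʳ-≤ (a x * g x) (≤-trans le (*-monoʳ-≤ (∑ xs a) gy≤gx)))
                                               (≤-reflexive (sym (*-distribʳ-+ (g x) (a x) (∑ xs a)))))

∑-map : {A B : Set} → ∀ (h : A → B) xs f → ∑ (map h xs) f ≡ ∑ xs (f ∘ h)
∑-map h [] f = refl
∑-map h (x ∷ xs) f = cong (f (h x) +_) (∑-map h xs f)

∑-concatMap : {A B : Set} → ∀ (h : A → List B) xs f → ∑ (concatMap h xs) f ≡ ∑ xs (λ x → ∑ (h x) f)
∑-concatMap h [] f = refl
∑-concatMap h (x ∷ xs) f = trans (∑-++ (h x) (concatMap h xs) f) (cong (∑ (h x) f +_) (∑-concatMap h xs f))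

picks : {A : Set} → List A → List (A × List A)
picks [] = []
picks (x ∷ xs) = (x , xs) ∷ map (map₂ (x ∷_)) (picks xs)

∑-picks : {A : Set} → ∀ (xs : List A) f → ∑ (picks xs) (f ∘ proj₁) ≡ ∑ xs f
∑-picks [] f = refl
∑-picks (x ∷ xs) f = cong (f x +_) (trans (∑-map (map₂ (x ∷_)) (picks xs) (f ∘ proj₁)) (∑-picks xs f))

module WeightedGraph {V : Set} (ω : V → V → ℕ) (ω-sym : ∀ u v → ω u v ≡ ω v u) where

  star : V → List V → ℕ
  star u U = ∑ U (ω u)

  -- Every pair inside the list is counted once, at whichever vertex comes first.
  mass : List V → ℕ
  mass [] = 0
  mass (u ∷ U) = star u U + mass U

  star-picks : ∀ U {z R} → (z , R) ∈ picks U → ∀ v → star v U ≡ ω v z + star v R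
  star-picks (x ∷ U) (here refl) v = refl
  star-picks (x ∷ U) (there p) v with (z , R) , q , refl ← ∈-map⁻ (map₂ (x ∷_)) p =
    trans (cong (ω v x +_) (star-picks U q v)) (exchange (ω v x) (ω v z) (star v R))
    where
    exchange : ∀ a b c → a + (b + c) ≡ b + (a + c)
    exchange = solve-∀

  -- The source of edge-disjointness: once `z` is removed, its star no longer belongs to the mass
  -- that remains, so later stars cannot spend it again.
  mass-picks : ∀ U {z R} → (z , R) ∈ picks U → mass U ≡ star z R + mass R
  mass-picks (x ∷ U) (here refl) = refl
  mass-picks (x ∷ U) (there p) with (z , R) , q , refl ← ∈-map⁻ (map₂ (x ∷_)) p =
    trans (cong₂ _+_ (trans (star-picks U q x) (cong (_+ star x R) (ω-sym x z))) (mass-picks U q))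
      (exchange (ω z x) (star x R) (star z R) (mass R))
    where
    exchange : ∀ a b c d → a + b + (c + d) ≡ a + c + (b + d)
    exchange = solve-∀

  -- The handshake lemma: each edge is seen from both of its ends.
  ∑-star-picks : ∀ U → ∑ (picks U) (λ (z , R) → star z R) ≡ 2 * mass U
  ∑-star-picks [] = refl
  ∑-star-picks (x ∷ U) = begin
    star x U + ∑ (map (map₂ (x ∷_)) (picks U)) (λ (z , R) → star z R)
      ≡⟨ cong (star x U +_) (∑-map (map₂ (x ∷_)) (picks U) (λ (z , R) → star z R)) ⟩
    star x U + ∑ (picks U) (λ (z , R) → ω z x + star z R)
      ≡⟨ cong (star x U +_) (∑-+ (picks U) (λ (z , R) → ω z x) (λ (z , R) → star z R)) ⟩
    star x U + (∑ (picks U) (λ (z , R) → ω z x) + ∑ (picks U) (λ (z , R) → star z R))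
      ≡⟨ cong₂ (λ a b → star x U + (a + b))
           (trans (∑-picks U (λ z → ω z x)) (∑-cong U (λ {z} _ → ω-sym z x))) (∑-star-picks U) ⟩
    star x U + (star x U + 2 * mass U)
      ≡⟨ double (star x U) (mass U) ⟩
    2 * (star x U + mass U) ∎
    where
    open ≡-Reasoning
    double : ∀ a b → a + (a + 2 * b) ≡ 2 * (a + b)
    double = solve-∀

  -- Total weight of the k-edge paths that start at u and continue inside U; a path that ends in v
  -- and leaves the vertices R of U unused is counted with the extra factor Ψ v R.
  arm : ℕ → V → List V → (V → List V → ℕ) → ℕ
  arm zero u U Ψ = Ψ u U
  arm (suc k) u U Ψ = ∑ (picks U) (λ (z , R) → ω u z * arm k z R Ψ)

  -- In `budget`, the star of `end` and the mass of `rest` are what later edges may still spend.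
  -- `star-rest≤` serves the other arm: the star of a vertex off this path only shrinks while the
  -- path is chosen.
  record GreedyPath (k : ℕ) (u : V) (U : List V) (Ψ : V → List V → ℕ) : Set where
    field
      stars       : List ℕ
      end         : V
      rest        : List V
      length≡     : length stars ≡ k
      arm≤        : arm k u U Ψ ≤ product stars * Ψ end rest
      budget      : sum stars + (star end rest + mass rest) ≤ star u U + mass U
      star-rest≤  : ∀ v → star v rest ≤ star v U

  -- Choosing the best neighbour at each step bounds the sum over paths by a product of star
  -- weights; successive stars are edge-disjoint, which gives the budget.
  greedy : ∀ k u U Ψ → GreedyPath k u U Ψ
  greedy zero u U Ψ = record
    { stars = [] ; end = u ; rest = U ; length≡ = refl ; arm≤ = ≤-reflexive (sym (+-identityʳ _))
    ; budget = ≤-refl ; star-rest≤ = λ _ → ≤-refl }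
  greedy (suc k) u U Ψ with ∑-weighted-max (picks U) (λ (z , R) → ω u z) (λ (z , R) → arm k z R Ψ)
  -- Dead end: the sum over paths is empty. Stars of weight zero make the product vanish as well, at
  -- no cost to the budget and with the right number of entries.
  ... | inj₁ picks≡[] = record
    { stars = replicate (suc k) 0 ; end = u ; rest = U ; length≡ = length-replicate (suc k)
    ; arm≤ = ≤-reflexive (cong (λ xs → ∑ xs (λ (z , R) → ω u z * arm k z R Ψ)) picks≡[])
    ; budget = ≤-reflexive (cong (_+ (star u U + mass U)) (trans (sum-replicate (suc k) 0) (*-zeroʳ (suc k))))
    ; star-rest≤ = λ _ → ≤-refl }
  ... | inj₂ ((z , R) , zR∈ , best) = record
    { stars = star u U ∷ stars ; end = end ; rest = rest ; length≡ = cong suc length≡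
    ; arm≤ = begin
        arm (suc k) u U Ψ                                    ≤⟨ best ⟩
        ∑ (picks U) (λ (z , R) → ω u z) * arm k z R Ψ        ≡⟨ cong (_* arm k z R Ψ) (∑-picks U (ω u)) ⟩
        star u U * arm k z R Ψ                               ≤⟨ *-monoʳ-≤ (star u U) arm≤ ⟩
        star u U * (product stars * Ψ end rest)              ≡⟨ *-assoc (star u U) _ _ ⟨
        star u U * product stars * Ψ end rest ∎
    ; budget = begin
        star u U + sum stars + (star end rest + mass rest)    ≡⟨ +-assoc (star u U) _ _ ⟩
        star u U + (sum stars + (star end rest + mass rest))  ≤⟨ +-monoʳ-≤ (star u U) budget ⟩
        star u U + (star z R + mass R)                        ≡⟨ cong (star u U +_) (mass-picks U zR∈) ⟨
        star u U + mass U ∎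
    ; star-rest≤ = λ v → ≤-trans (star-rest≤ v) (≤-trans (m≤n+m (star v R) (ω v z)) (≤-reflexive (sym (star-picks U zR∈ v))))
    }
    where
    open ≤-Reasoning
    open GreedyPath (greedy k z R Ψ)

  module _ {c : ℕ} (ω≤c : ∀ u v → ω u v ≤ c) where

    -- Last edge of an arm at u: it may close up at v, which counts twice, or go to an unused vertex.
    closing : V → V → List V → ℕ
    closing v u R = 2 * ω u v + star u R

    -- The last two edges of the arm at `u`, kept together because the two bounds below treat them
    -- jointly.
    closings : V → V → List V → ℕ
    closings v u R = ∑ (picks R) (λ (z , R′) → ω u z * closing v z R′)

    -- Whatever `z` is chosen, `star z R′` is part of `mass R`, one copy of `ω z v` is part of
    -- `star v R`, and the other copy is at most the weight `c` of the heaviest edge.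
    closings≤star : ∀ v u R → closings v u R ≤ star u R * ((mass R + star v R) + c)
    closings≤star v u R = begin
      closings v u R
        ≤⟨ ∑-mono (picks R) (λ {(z , R′)} zR′∈ → *-monoʳ-≤ (ω u z) (begin
             2 * ω z v + star z R′                      ≡⟨ lem (ω z v) (star z R′) ⟩
             star z R′ + ω z v + ω z v                  ≤⟨ +-mono-≤ (+-mono-≤ (≤-trans (m≤m+n _ (mass R′)) (≤-reflexive (sym (mass-picks R zR′∈))))
                                                            (≤-trans (≤-reflexive (ω-sym z v)) (≤-trans (m≤m+n _ (star v R′)) (≤-reflexive (sym (star-picks R zR′∈ v))))))
                                                           (ω≤c z v) ⟩
             mass R + star v R + c ∎)) ⟩
      ∑ (picks R) (λ (z , R′) → ω u z * ((mass R + star v R) + c))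
        ≡⟨ ∑-*ʳ (picks R) ((mass R + star v R) + c) (λ (z , R′) → ω u z) ⟩
      ∑ (picks R) (λ (z , R′) → ω u z) * ((mass R + star v R) + c)
        ≡⟨ cong (_* ((mass R + star v R) + c)) (∑-picks R (ω u)) ⟩
      star u R * ((mass R + star v R) + c) ∎
      where
      open ≤-Reasoning
      lem : ∀ a b → 2 * a + b ≡ b + a + a
      lem = solve-∀

    -- The edge from `u` to `z` is replaced by `c`, so `star u R` is not spent at all. Summing over
    -- `z` then counts the edges inside `R` from both ends, and those from `v` to `R` twice by the
    -- weight in `closing`.
    closings≤max : ∀ v u R → closings v u R ≤ 2 * (c * (mass R + star v R))
    closings≤max v u R = begin
      closings v u R
        ≤⟨ ∑-mono (picks R) (λ {(z , R′)} _ → *-monoˡ-≤ (closing v z R′) (ω≤c u z)) ⟩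
      ∑ (picks R) (λ (z , R′) → c * closing v z R′)
        ≡⟨ ∑-*ˡ (picks R) c (λ (z , R′) → closing v z R′) ⟩
      c * ∑ (picks R) (λ (z , R′) → closing v z R′)
        ≡⟨ cong (c *_) (∑-+ (picks R) (λ (z , R′) → 2 * ω z v) (λ (z , R′) → star z R′)) ⟩
      c * (∑ (picks R) (λ (z , R′) → 2 * ω z v) + ∑ (picks R) (λ (z , R′) → star z R′))
        ≡⟨ cong₂ (λ a b → c * (a + b))
             (trans (∑-picks R (λ z → 2 * ω z v)) (trans (∑-*ˡ R 2 (λ z → ω z v)) (cong (2 *_) (∑-cong R (λ {z} _ → ω-sym z v)))))
             (∑-star-picks R) ⟩
      c * (2 * star v R + 2 * mass R)
        ≡⟨ lem c (star v R) (mass R) ⟩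
      2 * (c * (mass R + star v R)) ∎
      where
      open ≤-Reasoning
      lem : ∀ a b c → a * (2 * b + 2 * c) ≡ 2 * (a * (c + b))
      lem = solve-∀

    -- The arm at `q` is run to its end `v` first, then the arm at `p` among the vertices left over,
    -- and last `closings` towards `v`. With m = 3 + i + j there are m - 3 greedy stars.
    two-arm-bound : ∀ {N} p q U i j → c + star p U + star q U + mass U ≤ N →
      arm j q U (λ v R → arm i p R (closings v)) * (3 + (i + j)) ^ (2 + (i + j)) * 1000 ≤ 2692 * N ^ (2 + (i + j))
    two-arm-bound {N} p q U i j U-budget = result
      where
      open ≤-Reasoning
      module Q = GreedyPath (greedy j q U (λ v R → arm i p R (closings v)))
      v = Q.end
      module P = GreedyPath (greedy i p Q.rest (closings v))
      u = P.end
      R = P.rest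
      X = arm j q U (λ v R → arm i p R (closings v))
      t = star u R
      Y = mass R + star v R
      ss = P.stars ++ Q.stars
      X≤ : X ≤ product ss * closings v u R
      X≤ = begin
        X                                                          ≤⟨ Q.arm≤ ⟩
        product Q.stars * arm i p Q.rest (closings v)              ≤⟨ *-monoʳ-≤ (product Q.stars) P.arm≤ ⟩
        product Q.stars * (product P.stars * closings v u R)       ≡⟨ lem (product Q.stars) (product P.stars) _ ⟩
        product P.stars * product Q.stars * closings v u R         ≡⟨ cong (_* closings v u R) (product-++ P.stars Q.stars) ⟨
        product ss * closings v u R ∎
        where
        lem : ∀ a b c → a * (b * c) ≡ b * a * c
        lem = solve-∀
      -- Unwinds the walks in reverse order. The star of `v` is held back while the arm at `p` runs,
      -- and that of `p` while the arm at `q` runs; `star-rest≤` covers both.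
      total : c + Y + sum ss + t ≤ N
      total = begin
        c + (mass R + star v R) + sum ss + t
          ≡⟨ cong (λ z → c + Y + z + t) (sum-++ P.stars Q.stars) ⟩
        c + (mass R + star v R) + (sum P.stars + sum Q.stars) + t
          ≡⟨ lem₁ c (mass R) (star v R) (sum P.stars) (sum Q.stars) t ⟩
        c + ((sum P.stars + (t + mass R)) + (star v R + sum Q.stars))
          ≤⟨ +-monoʳ-≤ c (+-mono-≤ P.budget (+-monoˡ-≤ (sum Q.stars) (P.star-rest≤ v))) ⟩
        c + ((star p Q.rest + mass Q.rest) + (star v Q.rest + sum Q.stars))
          ≡⟨ lem₂ c (star p Q.rest) (mass Q.rest) (star v Q.rest) (sum Q.stars) ⟩
        c + (star p Q.rest + (sum Q.stars + (star v Q.rest + mass Q.rest)))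
          ≤⟨ +-monoʳ-≤ c (+-mono-≤ (Q.star-rest≤ p) Q.budget) ⟩
        c + (star p U + (star q U + mass U))
          ≡⟨ lem₃ c (star p U) (star q U) (mass U) ⟩
        c + star p U + star q U + mass U
          ≤⟨ U-budget ⟩
        N ∎
        where
        lem₁ : ∀ c a b d e t → c + (a + b) + (d + e) + t ≡ c + ((d + (t + a)) + (b + e))
        lem₁ = solve-∀
        lem₂ : ∀ c a b d e → c + ((a + b) + (d + e)) ≡ c + (a + (e + (d + b)))
        lem₂ = solve-∀
        lem₃ : ∀ c a b d → c + (a + (b + d)) ≡ c + a + b + d
        lem₃ = solve-∀
      len : length ss ≡ i + j
      len = trans (length-++ P.stars) (cong₂ _+_ P.length≡ Q.length≡)
      result : X * (3 + (i + j)) ^ (2 + (i + j)) * 1000 ≤ 2692 * N ^ (2 + (i + j))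
      result with ≤-total (3 * N) (4 * (3 + (i + j)) * t)
      -- Here `c` and `Y` are separate factors and `t` stays unspent; in the other case `t` is
      -- itself a factor and `Y + c` a single one. Both products have m - 1 factors.
      ... | inj₁ large = large-star-bound {t = t} (c ∷ Y ∷ ss) (cong (2 +_) len)
              (≤-trans X≤ (≤-trans (*-monoʳ-≤ (product ss) (closings≤max v u R)) (≤-reflexive (lem (product ss) c Y))))
              (≤-trans (≤-reflexive (lem′ c Y (sum ss) t)) total) large
        where
        lem : ∀ p c y → p * (2 * (c * y)) ≡ 2 * (c * (y * p))
        lem = solve-∀
        lem′ : ∀ c y s t → c + (y + s) + t ≡ c + y + s + t
        lem′ = solve-∀
      ... | inj₂ small = small-star-bound {t = t} ((Y + c) ∷ ss) (cong suc len)
              (≤-trans X≤ (≤-trans (*-monoʳ-≤ (product ss) (closings≤star v u R)) (≤-reflexive (lem (product ss) t (Y + c)))))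
              (≤-trans (≤-reflexive (cong (λ z → z + sum ss + t) (+-comm Y c))) total) small
        where
        lem : ∀ p t y → p * (t * y) ≡ t * (y * p)
        lem = solve-∀

-- Sums over pairs of disjoint vertex sequences

module _ {A : Set} where

  picks-complete : ∀ {U : List A} {z} → z ∈ U → ∃ λ R → (z , R) ∈ picks U × (∀ {v} → v ∈ U → v ≢ z → v ∈ R)
  picks-complete {x ∷ U} (here refl) = U , here refl , λ { (here refl) v≢z → ⊥-elim (v≢z refl) ; (there v∈U) _ → v∈U }
  picks-complete {x ∷ U} (there z∈U) with R , zR∈ , keep ← picks-complete z∈U =
    x ∷ R , there (∈-map⁺ (map₂ (x ∷_)) zR∈) , λ { (here refl) _ → here refl ; (there v∈U) v≢z → there (keep v∈U v≢z) }

  seqs : ℕ → List A → List (List A × List A)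
  seqs zero U = [ [] , U ]
  seqs (suc k) U = concatMap (λ (z , R) → map (map₁ (z ∷_)) (seqs k R)) (picks U)

  seqs-complete : ∀ {s U : List A} → Unique s → (∀ {v} → v ∈ s → v ∈ U) →
                  ∃ λ R → (s , R) ∈ seqs (length s) U × (∀ {v} → v ∈ U → v ∉ s → v ∈ R)
  seqs-complete {[]} {U} _ _ = U , here refl , λ v∈U _ → v∈U
  seqs-complete {z ∷ s} (z∉s ∷ uniq) s⊆U with picks-complete (s⊆U (here refl))
  ... | R , zR∈ , keep with seqs-complete uniq (λ v∈s → keep (s⊆U (there v∈s)) (λ v≡z → All.lookup z∉s v∈s (sym v≡z)))
  ...   | R′ , sR′∈ , keep′ =
    R′ , ∈-concatMap⁺ _ (Any.map (λ { refl → ∈-map⁺ (map₁ (z ∷_)) sR′∈ }) zR∈)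
       , λ v∈U v∉zs → keep′ (keep v∈U (v∉zs ∘ here)) (v∉zs ∘ there)

  -- Pairs of disjoint sequences of lengths i and j; the second one is chosen first.
  armPairs : ℕ → ℕ → List A → List (List A × List A)
  armPairs i j U = concatMap (λ (t , R) → map (λ (s , _) → s , t) (seqs i R)) (seqs j U)

  armPairs-complete : ∀ {s t U : List A} → Unique s → Unique t → (∀ {v} → v ∈ s → v ∉ t) →
                      (∀ {v} → v ∈ s → v ∈ U) → (∀ {v} → v ∈ t → v ∈ U) →
                      (s , t) ∈ armPairs (length s) (length t) U
  armPairs-complete !s !t s∉t s⊆U t⊆U with seqs-complete !t t⊆U
  ... | R , tR∈ , keep with seqs-complete !s (λ v∈s → keep (s⊆U v∈s) (s∉t v∈s))
  ...   | R′ , sR′∈ , _ = ∈-concatMap⁺ _ (Any.map (λ { refl → ∈-map⁺ _ sR′∈ }) tR∈)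

  ∑-armPairs : ∀ i j (U : List A) (f : List A × List A → ℕ) →
               ∑ (armPairs i j U) f ≡ ∑ (seqs j U) (λ (t , R) → ∑ (seqs i R) (λ (s , _) → f (s , t)))
  ∑-armPairs i j U f = trans (∑-concatMap _ (seqs j U) f) (∑-cong (seqs j U) (λ {(t , R)} _ → ∑-map _ (seqs i R) f))

  endpoint : A → List A → A
  endpoint u [] = u
  endpoint u (z ∷ s) = endpoint z s

module Walks {V : Set} (ω : V → V → ℕ) (ω-sym : ∀ u v → ω u v ≡ ω v u) where
  open WeightedGraph ω ω-sym

  walk : V → List V → ℕ
  walk u [] = 1
  walk u (z ∷ s) = ω u z * walk z s

  -- The recursive form on the right suits the greedy bound, the explicit list of sequences on the
  -- left suits the comparison with subgraphs.
  ∑-seqs : ∀ k u U Ψ → ∑ (seqs k U) (λ (s , R) → walk u s * Ψ (endpoint u s) R) ≡ arm k u U Ψ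
  ∑-seqs zero u U Ψ = trans (+-identityʳ _) (+-identityʳ _)
  ∑-seqs (suc k) u U Ψ = trans (∑-concatMap _ (picks U) _) (∑-cong (picks U) (λ {(z , R)} _ → begin
    ∑ (map (map₁ (z ∷_)) (seqs k R)) (λ (s , R′) → walk u s * Ψ (endpoint u s) R′)
      ≡⟨ ∑-map (map₁ (z ∷_)) (seqs k R) _ ⟩
    ∑ (seqs k R) (λ (s , R′) → ω u z * walk z s * Ψ (endpoint z s) R′)
      ≡⟨ ∑-cong (seqs k R) (λ {(s , R′)} _ → *-assoc (ω u z) (walk z s) _) ⟩
    ∑ (seqs k R) (λ (s , R′) → ω u z * (walk z s * Ψ (endpoint z s) R′))
      ≡⟨ ∑-*ˡ (seqs k R) (ω u z) _ ⟩
    ω u z * ∑ (seqs k R) (λ (s , R′) → walk z s * Ψ (endpoint z s) R′)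
      ≡⟨ cong (ω u z *_) (∑-seqs k z R Ψ) ⟩
    ω u z * arm k z R Ψ ∎))
    where open ≡-Reasoning

  step : (V → List V → ℕ) → V → List V → ℕ
  step Ψ u U = arm 1 u U Ψ

  arm-cong : ∀ k u U {Ψ Ψ′} → (∀ v R → Ψ v R ≡ Ψ′ v R) → arm k u U Ψ ≡ arm k u U Ψ′
  arm-cong zero u U Ψ≡ = Ψ≡ u U
  arm-cong (suc k) u U Ψ≡ = ∑-cong (picks U) (λ {(z , R)} _ → cong (ω u z *_) (arm-cong k z R Ψ≡))

  arm-step : ∀ k u U Ψ → arm k u U (step Ψ) ≡ arm (suc k) u U Ψ
  arm-step zero u U Ψ = refl
  arm-step (suc k) u U Ψ = ∑-cong (picks U) (λ {(z , R)} _ → cong (ω u z *_) (arm-step k z R Ψ))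

  arm-linear : ∀ k u U Ψ Φ → arm k u U (λ v R → 2 * Ψ v R + Φ v R) ≡ 2 * arm k u U Ψ + arm k u U Φ
  arm-linear zero u U Ψ Φ = refl
  arm-linear (suc k) u U Ψ Φ = begin
    ∑ (picks U) (λ (z , R) → ω u z * arm k z R (λ v R → 2 * Ψ v R + Φ v R))
      ≡⟨ ∑-cong (picks U) (λ {(z , R)} _ → trans (cong (ω u z *_) (arm-linear k z R Ψ Φ)) (distrib (ω u z) _ _)) ⟩
    ∑ (picks U) (λ (z , R) → 2 * (ω u z * arm k z R Ψ) + ω u z * arm k z R Φ)
      ≡⟨ ∑-+ (picks U) (λ (z , R) → 2 * (ω u z * arm k z R Ψ)) (λ (z , R) → ω u z * arm k z R Φ) ⟩
    ∑ (picks U) (λ (z , R) → 2 * (ω u z * arm k z R Ψ)) + arm (suc k) u U Φ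
      ≡⟨ cong (_+ arm (suc k) u U Φ) (∑-*ˡ (picks U) 2 _) ⟩
    2 * arm (suc k) u U Ψ + arm (suc k) u U Φ ∎
    where
    open ≡-Reasoning
    distrib : ∀ a b c → a * (2 * b + c) ≡ 2 * (a * b) + a * c
    distrib = solve-∀

  pathWeight : V → V → List V × List V → ℕ
  pathWeight p q (s , t) = walk p s * walk q t

  cycleWeight : V → V → List V × List V → ℕ
  cycleWeight p q (s , t) = walk p s * walk q t * ω (endpoint p s) (endpoint q t)

  ∑-pathWeight : ∀ p q U i j → ∑ (armPairs i j U) (pathWeight p q) ≡ arm j q U (λ v R → arm i p R (λ _ _ → 1))
  ∑-pathWeight p q U i j = begin
    ∑ (armPairs i j U) (pathWeight p q)
      ≡⟨ ∑-armPairs i j U (pathWeight p q) ⟩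
    ∑ (seqs j U) (λ (t , R) → ∑ (seqs i R) (λ (s , _) → walk p s * walk q t))
      ≡⟨ ∑-cong (seqs j U) (λ {(t , R)} _ → trans (∑-cong (seqs i R) (λ {(s , _)} _ → lem (walk p s) (walk q t))) (∑-*ˡ (seqs i R) (walk q t) _)) ⟩
    ∑ (seqs j U) (λ (t , R) → walk q t * ∑ (seqs i R) (λ (s , _) → walk p s * 1))
      ≡⟨ ∑-cong (seqs j U) (λ {(t , R)} _ → cong (walk q t *_) (∑-seqs i p R (λ _ _ → 1))) ⟩
    ∑ (seqs j U) (λ (t , R) → walk q t * arm i p R (λ _ _ → 1))
      ≡⟨ ∑-seqs j q U (λ v R → arm i p R (λ _ _ → 1)) ⟩
    arm j q U (λ v R → arm i p R (λ _ _ → 1)) ∎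
    where
    open ≡-Reasoning
    lem : ∀ a b → a * b ≡ b * (a * 1)
    lem = solve-∀

  ∑-cycleWeight : ∀ p q U i j → ∑ (armPairs i j U) (cycleWeight p q) ≡ arm j q U (λ v R → arm i p R (λ u _ → ω u v))
  ∑-cycleWeight p q U i j = begin
    ∑ (armPairs i j U) (cycleWeight p q)
      ≡⟨ ∑-armPairs i j U (cycleWeight p q) ⟩
    ∑ (seqs j U) (λ (t , R) → ∑ (seqs i R) (λ (s , _) → walk p s * walk q t * ω (endpoint p s) (endpoint q t)))
      ≡⟨ ∑-cong (seqs j U) (λ {(t , R)} _ → trans (∑-cong (seqs i R) (λ {(s , _)} _ → lem (walk p s) (walk q t) _)) (∑-*ˡ (seqs i R) (walk q t) _)) ⟩
    ∑ (seqs j U) (λ (t , R) → walk q t * ∑ (seqs i R) (λ (s , _) → walk p s * ω (endpoint p s) (endpoint q t)))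
      ≡⟨ ∑-cong (seqs j U) (λ {(t , R)} _ → cong (walk q t *_) (∑-seqs i p R (λ u _ → ω u (endpoint q t)))) ⟩
    ∑ (seqs j U) (λ (t , R) → walk q t * arm i p R (λ u _ → ω u (endpoint q t)))
      ≡⟨ ∑-seqs j q U (λ v R → arm i p R (λ u _ → ω u v)) ⟩
    arm j q U (λ v R → arm i p R (λ u _ → ω u v)) ∎
    where
    open ≡-Reasoning
    lem : ∀ a b c → a * b * c ≡ b * (a * c)
    lem = solve-∀

  -- Cycles and paths share the whole arm at `q` and the first `i` edges of the arm at `p`. What
  -- remains is two edges in either case: one more arm edge and the closing edge of the cycle, or
  -- two more arm edges of the path. Together they form `closings`.
  armPairs-bound : ∀ {c N} → (∀ u v → ω u v ≤ c) → ∀ p q U i j → c + star p U + star q U + mass U ≤ N →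
    (2 * ∑ (armPairs (1 + i) j U) (cycleWeight p q) + ∑ (armPairs (2 + i) j U) (pathWeight p q))
      * (3 + (i + j)) ^ (2 + (i + j)) * 1000 ≤ 2692 * N ^ (2 + (i + j))
  armPairs-bound {c} {N} ω≤c p q U i j budget =
    subst (λ X → X * (3 + (i + j)) ^ (2 + (i + j)) * 1000 ≤ 2692 * N ^ (2 + (i + j))) (sym eq) (two-arm-bound ω≤c p q U i j budget)
    where
    open ≡-Reasoning
    cycles : V → V → List V → ℕ
    cycles v u R = ω u v
    paths : V → List V → ℕ
    paths u R = 1
    closings≡ : ∀ v u R → closings ω≤c v u R ≡ 2 * step (cycles v) u R + step (step paths) u R
    closings≡ v u R = begin
      ∑ (picks R) (λ (z , R′) → ω u z * (2 * ω z v + star z R′))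
        ≡⟨ ∑-cong (picks R) (λ {(z , R′)} _ → trans (cong (λ a → ω u z * (2 * ω z v + a)) (star≡ z R′)) (distrib (ω u z) (ω z v) _)) ⟩
      ∑ (picks R) (λ (z , R′) → 2 * (ω u z * ω z v) + ω u z * step paths z R′)
        ≡⟨ ∑-+ (picks R) (λ (z , R′) → 2 * (ω u z * ω z v)) (λ (z , R′) → ω u z * step paths z R′) ⟩
      ∑ (picks R) (λ (z , R′) → 2 * (ω u z * ω z v)) + step (step paths) u R
        ≡⟨ cong (_+ step (step paths) u R) (∑-*ˡ (picks R) 2 _) ⟩
      2 * step (cycles v) u R + step (step paths) u R ∎
      where
      distrib : ∀ a b c → a * (2 * b + c) ≡ 2 * (a * b) + a * c
      distrib = solve-∀
      star≡ : ∀ z R → star z R ≡ step paths z R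
      star≡ z R = sym (trans (∑-cong (picks R) (λ {(y , _)} _ → *-identityʳ (ω z y))) (∑-picks R (ω z)))
    eq : 2 * ∑ (armPairs (1 + i) j U) (cycleWeight p q) + ∑ (armPairs (2 + i) j U) (pathWeight p q)
       ≡ arm j q U (λ v R → arm i p R (closings ω≤c v))
    eq = begin
      2 * ∑ (armPairs (1 + i) j U) (cycleWeight p q) + ∑ (armPairs (2 + i) j U) (pathWeight p q)
        ≡⟨ cong₂ (λ a b → 2 * a + b) (∑-cycleWeight p q U (1 + i) j) (∑-pathWeight p q U (2 + i) j) ⟩
      2 * arm j q U (λ v R → arm (1 + i) p R (cycles v)) + arm j q U (λ v R → arm (2 + i) p R paths)
        ≡⟨ arm-linear j q U _ _ ⟨
      arm j q U (λ v R → 2 * arm (1 + i) p R (cycles v) + arm (2 + i) p R paths)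
        ≡⟨ arm-cong j q U (λ v R → begin
             2 * arm (1 + i) p R (cycles v) + arm (2 + i) p R paths
               ≡⟨ cong₂ (λ a b → 2 * a + b) (arm-step i p R (cycles v)) (trans (arm-step i p R (step paths)) (arm-step (1 + i) p R paths)) ⟨
             2 * arm i p R (step (cycles v)) + arm i p R (step (step paths))
               ≡⟨ arm-linear i p R _ _ ⟨
             arm i p R (λ u R → 2 * step (cycles v) u R + step (step paths) u R)
               ≡⟨ arm-cong i p R (closings≡ v) ⟨
             arm i p R (closings ω≤c v) ∎) ⟩
      arm j q U (λ v R → arm i p R (closings ω≤c v)) ∎

-- Subgraphs as sublists of the edge list

concatMap-unique : {A B : Set} {f : A → List B} {xs : List A} → Unique xs → (∀ x → Unique (f x)) →
                   (∀ {x y z} → z ∈ f x → z ∈ f y → x ≡ y) → Unique (concatMap f xs)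
concatMap-unique !xs !f disjoint =
  Unique.concat⁺ (All.map⁺ (All.universal !f _))
    (AllPairs.map⁺ (AllPairs.map (λ x≢y {_} (z∈fx , z∈fy) → x≢y (disjoint z∈fx z∈fy)) !xs))

module _ {A : Set} where

  any-true : (p : A → Bool) (xs : List A) → any p xs ≡ true → ∃ λ x → x ∈ xs × p x ≡ true
  any-true p (x ∷ xs) eq with p x in px
  ... | true = x , here refl , px
  ... | false with y , y∈xs , py ← any-true p xs eq = y , there y∈xs , py

  all-true : (p : A → Bool) (xs : List A) → all p xs ≡ true → ∀ {x} → x ∈ xs → p x ≡ true
  all-true p (x ∷ xs) eq y∈ with p x in px
  all-true p (x ∷ xs) eq (here refl) | true = px
  all-true p (x ∷ xs) eq (there y∈xs) | true = all-true p xs eq y∈xs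

∧-true : ∀ a {b} → a ∧ b ≡ true → a ≡ true × b ≡ true
∧-true true {true} refl = refl , refl

∨-true : ∀ a {b} → a ∨ b ≡ true → a ≡ true ⊎ b ≡ true
∨-true true _ = inj₁ refl
∨-true false eq = inj₂ eq

module _ {A : Set} where

  ∈sublists⇒⊆ : ∀ {E S : List A} → S ∈ sublists E → ∀ {e} → e ∈ S → e ∈ E
  ∈sublists⇒⊆ {[]} (here refl) ()
  ∈sublists⇒⊆ {x ∷ E} S∈ e∈S with ∈-++⁻ (map (x ∷_) (sublists E)) S∈
  ... | inj₂ S∈′ = there (∈sublists⇒⊆ S∈′ e∈S)
  ... | inj₁ xS∈ with S′ , S′∈ , refl ← ∈-map⁻ (x ∷_) xS∈ with e∈S
  ...   | here refl = here refl
  ...   | there e∈S′ = there (∈sublists⇒⊆ S′∈ e∈S′)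

  ∈sublists⇒Unique : ∀ {E S : List A} → Unique E → S ∈ sublists E → Unique S
  ∈sublists⇒Unique {[]} _ (here refl) = []
  ∈sublists⇒Unique {x ∷ E} (x∉E ∷ !E) S∈ with ∈-++⁻ (map (x ∷_) (sublists E)) S∈
  ... | inj₂ S∈′ = ∈sublists⇒Unique !E S∈′
  ... | inj₁ xS∈ with S′ , S′∈ , refl ← ∈-map⁻ (x ∷_) xS∈ =
    All.tabulate (λ e∈S′ → All.lookup x∉E (∈sublists⇒⊆ S′∈ e∈S′)) ∷ ∈sublists⇒Unique !E S′∈

  sublists-unique : ∀ {E : List A} → Unique E → Unique (sublists E)
  sublists-unique {[]} _ = [] ∷ []
  sublists-unique {x ∷ E} (x∉E ∷ !E) =
    Unique.++⁺ (Unique.map⁺ (λ { refl → refl }) (sublists-unique !E)) (sublists-unique !E)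
      λ { (xS∈ , S∈) → clash xS∈ S∈ }
    where
    clash : ∀ {S} → S ∈ map (x ∷_) (sublists E) → ¬ (S ∈ sublists E)
    clash xS∈ S∈ with S′ , _ , refl ← ∈-map⁻ (x ∷_) xS∈ = All.lookup x∉E (∈sublists⇒⊆ S∈ (here refl)) refl

  -- Sublists keep the order of `E`, so equal edge sets are equal lists. This supplies the
  -- injectivity that `∑-dominate` asks for.
  sublists-ext : ∀ {E S S′ : List A} → Unique E → S ∈ sublists E → S′ ∈ sublists E →
                 (∀ {e} → e ∈ S → e ∈ S′) → (∀ {e} → e ∈ S′ → e ∈ S) → S ≡ S′
  sublists-ext {[]} _ (here refl) (here refl) _ _ = refl
  sublists-ext {x ∷ E} (x∉E ∷ !E) S∈ S′∈ S⊆S′ S′⊆S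
    with ∈-++⁻ (map (x ∷_) (sublists E)) S∈ | ∈-++⁻ (map (x ∷_) (sublists E)) S′∈
  ... | inj₂ p | inj₂ q = sublists-ext !E p q S⊆S′ S′⊆S
  ... | inj₂ p | inj₁ q with _ , _ , refl ← ∈-map⁻ (x ∷_) q =
    ⊥-elim (All.lookup x∉E (∈sublists⇒⊆ p (S′⊆S (here refl))) refl)
  ... | inj₁ p | inj₂ q with _ , _ , refl ← ∈-map⁻ (x ∷_) p =
    ⊥-elim (All.lookup x∉E (∈sublists⇒⊆ q (S⊆S′ (here refl))) refl)
  ... | inj₁ p | inj₁ q with S , S∈E , refl ← ∈-map⁻ (x ∷_) p | S′ , S′∈E , refl ← ∈-map⁻ (x ∷_) q =
    cong (x ∷_) (sublists-ext !E S∈E S′∈E (strip S∈E S⊆S′) (strip S′∈E S′⊆S))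
    where
    strip : ∀ {T T′} → T ∈ sublists E → (∀ {e} → e ∈ x ∷ T → e ∈ x ∷ T′) → ∀ {e} → e ∈ T → e ∈ T′
    strip T∈ T⊆T′ e∈T with T⊆T′ (there e∈T)
    ... | here refl = ⊥-elim (All.lookup x∉E (∈sublists⇒⊆ T∈ e∈T) refl)
    ... | there e∈T′ = e∈T′

unique⊆⇒↭ : {A : Set} {S I : List A} → Unique S → Unique I → (∀ {e} → e ∈ S → e ∈ I) → (∀ {e} → e ∈ I → e ∈ S) → S ↭ I
unique⊆⇒↭ !S !I S⊆I I⊆S = ∼bag⇒↭ (unique∧set⇒bag !S !I (mk⇔ S⊆I I⊆S))

Unique-resp-↭ : {A : Set} {xs ys : List A} → xs ↭ ys → Unique xs → Unique ys
Unique-resp-↭ p = Setoid↭.Unique-resp-↭ (setoid _) (↭⇒↭ₛ p)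

-- Comparison along a partial injection given as a relation. The `y` that serves the first `S` is
-- deleted from `M`; no later `S′` can ask for it, since a shared `y` would force S ≡ S′.
∑-dominate : {A B : Set} (L : List A) (M : List B) (f : A → ℕ) (g : B → ℕ) (_▷_ : A → B → Set) → Unique L →
             (∀ {S S′ y} → S ∈ L → S′ ∈ L → S ▷ y → S′ ▷ y → S ≡ S′) →
             (∀ {S} → S ∈ L → f S ≡ 0 ⊎ ∃ λ y → y ∈ M × S ▷ y × f S ≤ g y) → ∑ L f ≤ ∑ M g
∑-dominate [] M f g _▷_ _ _ _ = z≤n
∑-dominate (S ∷ L) M f g _▷_ (S∉L ∷ !L) inj witness with witness (here refl)
... | inj₁ fS≡0 = ≤-trans (≤-reflexive (cong (_+ ∑ L f) fS≡0))
        (∑-dominate L M f g _▷_ !L (λ p q → inj (there p) (there q)) (witness ∘ there))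
... | inj₂ (y , y∈M , S▷y , fS≤gy) with ys , zs , refl ← ∈-∃++ y∈M = begin
  f S + ∑ L f                ≤⟨ +-mono-≤ fS≤gy (∑-dominate L (ys ++ zs) f g _▷_ !L (λ p q → inj (there p) (there q)) witness′) ⟩
  g y + ∑ (ys ++ zs) g       ≡⟨ cong (g y +_) (∑-++ ys zs g) ⟩
  g y + (∑ ys g + ∑ zs g)    ≡⟨ lem (g y) (∑ ys g) (∑ zs g) ⟩
  ∑ ys g + (g y + ∑ zs g)    ≡⟨ ∑-++ ys (y ∷ zs) g ⟨
  ∑ (ys ++ y ∷ zs) g ∎
  where
  open ≤-Reasoning
  lem : ∀ a b c → a + (b + c) ≡ b + (a + c)
  lem = solve-∀
  witness′ : ∀ {S′} → S′ ∈ L → f S′ ≡ 0 ⊎ ∃ λ y → y ∈ ys ++ zs × S′ ▷ y × f S′ ≤ g y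
  witness′ S′∈L with witness (there S′∈L)
  ... | inj₁ f≡0 = inj₁ f≡0
  ... | inj₂ (y′ , y′∈ , S′▷y′ , le) with ∈-resp-↭ (shift y ys zs) y′∈
  ...   | here refl = ⊥-elim (All.lookup S∉L S′∈L (inj (here refl) (there S′∈L) S▷y S′▷y′))
  ...   | there y′∈′ = inj₂ (y′ , y′∈′ , S′▷y′ , le)

-- Splitting paths and cycles at an edge

<ᵇ-true : ∀ {a b} → a < b → (a <ᵇ b) ≡ true
<ᵇ-true {a} {b} a<b with a <ᵇ b | <⇒<ᵇ a<b
... | true | _ = refl

<ᵇ-false : ∀ {a b} → b ≤ a → (a <ᵇ b) ≡ false
<ᵇ-false {a} {b} b≤a with a <ᵇ b in eq
... | false = refl
... | true = ⊥-elim (≤⇒≯ b≤a (<ᵇ⇒< a b (subst T (sym eq) tt)))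

module _ {n : ℕ} where

  Edge : Set
  Edge = Fin n × Fin n

  Increasing : Edge → Set
  Increasing (u , v) = toℕ u < toℕ v

  -- The form in which `edgeList` stores an edge, so that equality of undirected edges becomes
  -- equality of pairs.
  norm : Edge → Edge
  norm (u , v) = if toℕ u <ᵇ toℕ v then (u , v) else (v , u)

  norm-increasing : ∀ {e} → Increasing e → norm e ≡ e
  norm-increasing {u , v} u<v rewrite <ᵇ-true u<v = refl

  norm-decreasing : ∀ {u v} → Increasing (v , u) → norm (u , v) ≡ (v , u)
  norm-decreasing {u} {v} v<u rewrite <ᵇ-false {toℕ u} {toℕ v} (<⇒≤ v<u) = refl

  norm-swap : ∀ u v → norm (u , v) ≡ norm (v , u)
  norm-swap u v with <-cmp (toℕ u) (toℕ v)
  ... | tri< u<v _ _ = trans (norm-increasing u<v) (sym (norm-decreasing u<v))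
  ... | tri> _ _ v<u = trans (norm-decreasing v<u) (sym (norm-increasing v<u))
  ... | tri≈ _ u≡v _ with refl ← Fin.toℕ-injective u≡v = refl

  norm-cases : ∀ u v → norm (u , v) ≡ (u , v) ⊎ norm (u , v) ≡ (v , u)
  norm-cases u v with toℕ u <ᵇ toℕ v
  ... | true = inj₁ refl
  ... | false = inj₂ refl

  norm-injective : ∀ {u v a b} → norm (u , v) ≡ norm (a , b) → (u , v) ≡ (a , b) ⊎ (u , v) ≡ (b , a)
  norm-injective {u} {v} {a} {b} eq with norm-cases u v | norm-cases a b
  ... | inj₁ p | inj₁ q with refl ← trans (sym p) (trans eq q) = inj₁ refl
  ... | inj₁ p | inj₂ q with refl ← trans (sym p) (trans eq q) = inj₂ refl
  ... | inj₂ p | inj₁ q with refl ← trans (sym p) (trans eq q) = inj₂ refl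
  ... | inj₂ p | inj₂ q with refl ← trans (sym p) (trans eq q) = inj₁ refl

  trail : Fin n → List (Fin n) → List Edge
  trail u [] = []
  trail u (z ∷ s) = norm (u , z) ∷ trail z s

  trail-∷ʳ : ∀ u s z → trail u (s ∷ʳ z) ≡ trail u s ∷ʳ norm (endpoint u s , z)
  trail-∷ʳ u [] z = refl
  trail-∷ʳ u (y ∷ s) z = cong (norm (u , y) ∷_) (trail-∷ʳ y s z)

  endpoint-∷ʳ : ∀ (u : Fin n) s z → endpoint u (s ∷ʳ z) ≡ z
  endpoint-∷ʳ u [] z = refl
  endpoint-∷ʳ u (y ∷ s) z = endpoint-∷ʳ y s z

  endpoint-∈ : ∀ (u : Fin n) s → endpoint u s ∈ u ∷ s
  endpoint-∈ u [] = here refl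
  endpoint-∈ u (z ∷ s) = there (endpoint-∈ z s)

  length-trail : ∀ u s → length (trail u s) ≡ length s
  length-trail u [] = refl
  length-trail u (z ∷ s) = cong suc (length-trail z s)

  trail-∈ : ∀ {u s e} → e ∈ trail u s → ∃₂ λ a b → e ≡ norm (a , b) × a ∈ u ∷ s × b ∈ u ∷ s
  trail-∈ {u} {z ∷ s} (here refl) = u , z , refl , here refl , there (here refl)
  trail-∈ {u} {z ∷ s} (there e∈) with a , b , eq , a∈ , b∈ ← trail-∈ e∈ = a , b , eq , there a∈ , there b∈

  ∉trail : ∀ {u z y s} → u ∉ z ∷ s → norm (u , y) ∉ trail z s
  ∉trail u∉ e∈ with a , b , eq , a∈ , b∈ ← trail-∈ e∈ with norm-injective eq
  ... | inj₁ refl = u∉ a∈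
  ... | inj₂ refl = u∉ b∈

  trail-unique : ∀ {u s} → Unique (u ∷ s) → Unique (trail u s)
  trail-unique {u} {[]} _ = []
  trail-unique {u} {z ∷ s} (u∉ ∷ !s) =
    All.tabulate (λ {e} e∈ eq → ∉trail (λ u∈ → All.lookup u∉ u∈ refl) (subst (_∈ trail z s) (sym eq) e∈)) ∷ trail-unique !s

  -- At least three vertices are present: with only `u` and `y`, the closing edge would repeat the
  -- first edge.
  closed-trail-unique : ∀ {u y z s} → Unique (u ∷ y ∷ z ∷ s) →
                        Unique (norm (endpoint u (y ∷ z ∷ s) , u) ∷ trail u (y ∷ z ∷ s))
  closed-trail-unique {u} {y} {z} {s} !us@(u∉ ∷ y∉ ∷ _) = All.tabulate fresh ∷ trail-unique !us
    where
    l = endpoint z s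
    fresh : ∀ {e} → e ∈ trail u (y ∷ z ∷ s) → norm (l , u) ≢ e
    fresh (here refl) eq with norm-injective eq
    ... | inj₁ refl = All.lookup u∉ (here refl) refl
    ... | inj₂ refl = All.lookup y∉ (endpoint-∈ z s) refl
    fresh (there e∈) refl = ∉trail {s = z ∷ s} (λ u∈ → All.lookup u∉ u∈ refl) (subst (_∈ trail y (z ∷ s)) (norm-swap l u) e∈)

  -- S is the path s reversed, p, q, t: the arms s and t leave the edge {p,q} from p and from q.
  PathSplit : Fin n → Fin n → List Edge → List (Fin n) → List (Fin n) → Set
  PathSplit p q S s t = S ↭ norm (p , q) ∷ trail p s ++ trail q t × Unique (p ∷ q ∷ s ++ t)

  CycleSplit : Fin n → Fin n → List Edge → List (Fin n) → List (Fin n) → Set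
  CycleSplit p q S s t =
    S ↭ norm (p , q) ∷ norm (endpoint p s , endpoint q t) ∷ trail p s ++ trail q t × Unique (p ∷ q ∷ s ++ t)

  vertices-swap : ∀ p q (s t : List (Fin n)) → Unique (p ∷ q ∷ s ++ t) → Unique (q ∷ p ∷ t ++ s)
  vertices-swap p q s t = Unique-resp-↭ (swap p q (++-comm s t))

  PathSplit-swap : ∀ {p q S} s t → PathSplit p q S s t → PathSplit q p S t s
  PathSplit-swap {p} {q} {S} s t (S↭ , !v) =
    ↭-trans S↭ (↭-trans (↭-reflexive (cong (_∷ trail p s ++ trail q t) (norm-swap p q))) (prep _ (++-comm (trail p s) (trail q t))))
    , vertices-swap p q s t !v

  CycleSplit-swap : ∀ {p q S} s t → CycleSplit p q S s t → CycleSplit q p S t s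
  CycleSplit-swap {p} {q} {S} s t (S↭ , !v) =
    ↭-trans S↭ (↭-trans (↭-reflexive (cong₂ (λ e f → e ∷ f ∷ trail p s ++ trail q t) (norm-swap p q) (norm-swap (endpoint p s) (endpoint q t))))
      (prep _ (prep _ (++-comm (trail p s) (trail q t)))))
    , vertices-swap p q s t !v

  -- Moving `z` from one arm end to the other exchanges two edges: the last edge of the first arm
  -- becomes the closing edge, and the old closing edge becomes the last edge of the second arm.
  CycleSplit-shift : ∀ {p q S} s z t → CycleSplit p q S (s ∷ʳ z) t → CycleSplit p q S s (t ∷ʳ z)
  CycleSplit-shift {p} {q} {S} s z t (S↭ , !v) = ↭-trans S↭ (prep _ edges↭) , Unique-resp-↭ (prep p (prep q vertices↭)) !v
    where
    vertices↭ : (s ∷ʳ z) ++ t ↭ s ++ (t ∷ʳ z)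
    vertices↭ = ↭-trans (↭-reflexive (++-assoc s [ z ] t)) (++⁺ˡ s (∷↭∷ʳ z t))
    edges↭ : norm (endpoint p (s ∷ʳ z) , endpoint q t) ∷ trail p (s ∷ʳ z) ++ trail q t
          ↭ norm (endpoint p s , endpoint q (t ∷ʳ z)) ∷ trail p s ++ trail q (t ∷ʳ z)
    edges↭ rewrite endpoint-∷ʳ p s z | endpoint-∷ʳ q t z | trail-∷ʳ p s z | trail-∷ʳ q t z | norm-swap (endpoint q t) z = begin
      f ∷ (trail p s ∷ʳ g) ++ trail q t      ≡⟨ cong (f ∷_) (++-assoc (trail p s) [ g ] (trail q t)) ⟩
      f ∷ trail p s ++ g ∷ trail q t         ↭⟨ prep f (shift g (trail p s) (trail q t)) ⟩
      f ∷ g ∷ trail p s ++ trail q t         ↭⟨ swap f g ↭-refl ⟩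
      g ∷ f ∷ trail p s ++ trail q t         ↭⟨ prep g (shift f (trail p s) (trail q t)) ⟨
      g ∷ trail p s ++ f ∷ trail q t         ↭⟨ prep g (++⁺ˡ (trail p s) (∷↭∷ʳ f (trail q t))) ⟩
      g ∷ trail p s ++ (trail q t ∷ʳ f) ∎
      where
      open PermutationReasoning
      f = norm (z , endpoint q t)
      g = norm (endpoint p s , z)

  CycleSplit-shrink : ∀ {p q S} d {k} s t → length s ≡ d + k → CycleSplit p q S s t →
                      ∃₂ λ s′ t′ → length s′ ≡ k × length t′ ≡ d + length t × CycleSplit p q S s′ t′
  CycleSplit-shrink zero s t eq c = s , t , eq , refl , c
  CycleSplit-shrink (suc d) s t eq c with initLast s
  ... | s′ ∷ʳ′ z with s″ , t″ , eq₁ , eq₂ , c′ ← CycleSplit-shrink d s′ (t ∷ʳ z) (suc-injective (trans (sym (trans (length-++ s′) (+-comm (length s′) 1))) eq)) (CycleSplit-shift s′ z t c) =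
    s″ , t″ , eq₁ , trans eq₂ (trans (cong (d +_) (trans (length-++ t) (+-comm (length t) 1))) (+-suc d (length t))) , c′

  complement-length : ∀ {i j k l} → i ≤ k → k + l ≡ i + j → k ∸ i + l ≡ j
  complement-length {i} {j} {k} {l} i≤k eq = +-cancelˡ-≡ i _ _
    (trans (sym (+-assoc i _ _)) (trans (cong (_+ l) (m+[n∸m]≡n i≤k)) eq))

  complement-≤ : ∀ {i j k l} → k ≤ i → k + l ≡ i + j → j ≤ l
  complement-≤ {i} {j} {k} k≤i eq = +-cancelˡ-≤ k _ _ (≤-trans (+-monoˡ-≤ j k≤i) (≤-reflexive (sym eq)))

  -- A path through `f` has its arm lengths fixed, but a cycle can be cut at any edge other than
  -- `f`. Hence each cycle may be charged once at every one of the m positions, which accounts for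
  -- the coefficient 2m.
  CycleSplit-anywhere : ∀ {p q S} s t i j → length s + length t ≡ i + j → CycleSplit p q S s t →
                        ∃₂ λ s′ t′ → length s′ ≡ i × length t′ ≡ j × CycleSplit p q S s′ t′
  CycleSplit-anywhere s t i j eq c with ≤-total i (length s)
  ... | inj₁ i≤s with s′ , t′ , eq₁ , eq₂ , c′ ← CycleSplit-shrink (length s ∸ i) s t (sym (m∸n+n≡m i≤s)) c =
    s′ , t′ , eq₁ , trans eq₂ (complement-length i≤s eq) , c′
  CycleSplit-anywhere s t i j eq c | inj₂ s≤i
    with j≤t ← complement-≤ s≤i eq
    with t′ , s′ , eq₁ , eq₂ , c′ ← CycleSplit-shrink (length t ∸ j) t s (sym (m∸n+n≡m j≤t)) (CycleSplit-swap s t c) =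
    s′ , t′ , trans eq₂ (complement-length j≤t (trans (+-comm (length t) _) (trans eq (+-comm i j)))) , eq₁ , CycleSplit-swap t′ s′ c′

  -- The arm `A` runs backwards from `e` to the start of the trail, `B` forwards to its end. The two
  -- ends are recorded because the closing edge of a cycle joins them.
  record TrailSplit (u : Fin n) (s : List (Fin n)) (e : Edge) : Set where
    field
      a b      : Fin n
      A B      : List (Fin n)
      e≡       : e ≡ norm (a , b)
      edges↭    : trail u s ↭ norm (a , b) ∷ trail a A ++ trail b B
      vertices↭ : u ∷ s ↭ a ∷ b ∷ A ++ B
      A-end    : endpoint a A ≡ u
      B-end    : endpoint b B ≡ endpoint u s

  trail-split : ∀ {u s e} → e ∈ trail u s → TrailSplit u s e
  trail-split {u} {z ∷ s} (here refl) = record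
    { a = u ; b = z ; A = [] ; B = s ; e≡ = refl ; edges↭ = ↭-refl ; vertices↭ = ↭-refl ; A-end = refl ; B-end = refl }
  trail-split {u} {z ∷ s} (there e∈) = record
    { a = a ; b = b ; A = A ∷ʳ u ; B = B ; e≡ = e≡
    ; edges↭ = begin
        norm (u , z) ∷ trail z s                                      ↭⟨ prep _ edges↭ ⟩
        norm (u , z) ∷ norm (a , b) ∷ trail a A ++ trail b B          ↭⟨ swap _ _ ↭-refl ⟩
        norm (a , b) ∷ norm (u , z) ∷ trail a A ++ trail b B          ↭⟨ prep _ (shift _ (trail a A) (trail b B)) ⟨
        norm (a , b) ∷ trail a A ++ norm (u , z) ∷ trail b B          ≡⟨ cong (norm (a , b) ∷_) (++-assoc (trail a A) [ norm (u , z) ] (trail b B)) ⟨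
        norm (a , b) ∷ (trail a A ∷ʳ norm (u , z)) ++ trail b B       ≡⟨ cong (λ f → norm (a , b) ∷ (trail a A ∷ʳ f) ++ trail b B)
                                                                         (trans (norm-swap u z) (cong (λ y → norm (y , u)) (sym A-end))) ⟩
        norm (a , b) ∷ (trail a A ∷ʳ norm (endpoint a A , u)) ++ trail b B  ≡⟨ cong (λ f → norm (a , b) ∷ f ++ trail b B) (trail-∷ʳ a A u) ⟨
        norm (a , b) ∷ trail a (A ∷ʳ u) ++ trail b B ∎
    ; vertices↭ = begin
        u ∷ z ∷ s                  ↭⟨ prep u vertices↭ ⟩
        u ∷ a ∷ b ∷ A ++ B         ↭⟨ swap u a ↭-refl ⟩
        a ∷ u ∷ b ∷ A ++ B         ↭⟨ prep a (swap u b ↭-refl) ⟩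
        a ∷ b ∷ u ∷ A ++ B         ↭⟨ prep a (prep b (shift u A B)) ⟨
        a ∷ b ∷ A ++ u ∷ B         ≡⟨ cong (λ l → a ∷ b ∷ l) (++-assoc A [ u ] B) ⟨
        a ∷ b ∷ (A ∷ʳ u) ++ B ∎
    ; A-end = endpoint-∷ʳ a A u ; B-end = B-end }
    where
    open PermutationReasoning
    open TrailSplit (trail-split e∈)

-- Reading paths and cycles off the isomorphism test

==⇒≡ : ∀ {n} (a b : Fin n) → (a == b) ≡ true → a ≡ b
==⇒≡ a b eq = Fin.toℕ-injective (≡ᵇ⇒≡ (toℕ a) (toℕ b) (subst T (sym eq) tt))

==-refl : ∀ {n} (a : Fin n) → (a == a) ≡ true
==-refl a with toℕ a ≡ᵇ toℕ a | ≡⇒≡ᵇ (toℕ a) (toℕ a) refl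
... | true | _ = refl

cell : ∀ {n} → Fin n → Fin n → List (Fin n × Fin n)
cell i j = if toℕ i <ᵇ toℕ j then (i , j) ∷ [] else []

row : ∀ {n} → Fin n → List (Fin n × Fin n)
row {n} i = concatMap (cell i) (allFin n)

∈cell : ∀ {n} {i j : Fin n} {e} → e ∈ cell i j → e ≡ (i , j) × Increasing e
∈cell {i = i} {j} e∈ with toℕ i <ᵇ toℕ j in i<j
∈cell {i = i} {j} (here refl) | true = refl , <ᵇ⇒< (toℕ i) (toℕ j) (subst T (sym i<j) tt)

∈row : ∀ {n} {i : Fin n} {e} → e ∈ row i → proj₁ e ≡ i × Increasing e
∈row {n} {i} e∈ with _ , _ , e∈cell ← find (∈-concatMap⁻ (cell i) {xs = allFin n} e∈) with refl , inc ← ∈cell e∈cell = refl , inc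

∈edgeList⇒Increasing : ∀ {n e} → e ∈ edgeList n → Increasing e
∈edgeList⇒Increasing {n} e∈ with _ , _ , e∈row ← find (∈-concatMap⁻ row {xs = allFin n} e∈) = proj₂ (∈row e∈row)

edgeList-unique : ∀ n → Unique (edgeList n)
edgeList-unique n = concatMap-unique (Unique.allFin⁺ n)
  (λ i → concatMap-unique (Unique.allFin⁺ n) (cell-unique i)
    (λ p q → cong proj₂ (trans (sym (proj₁ (∈cell p))) (proj₁ (∈cell q)))))
  (λ p q → trans (sym (proj₁ (∈row p))) (proj₁ (∈row q)))
  where
  cell-unique : ∀ i j → Unique (cell i j)
  cell-unique i j with toℕ i <ᵇ toℕ j
  ... | true = [] ∷ []
  ... | false = []

sameEdge⇒norm : ∀ {n} {e a : Fin n × Fin n} → Increasing e → sameEdge e a ≡ true → e ≡ norm a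
sameEdge⇒norm {e = u , v} {a , b} u<v eq with ∨-true ((u == a) ∧ (v == b)) eq
... | inj₁ eq₁ with ua , vb ← ∧-true (u == a) eq₁ with refl ← ==⇒≡ u a ua | refl ← ==⇒≡ v b vb = sym (norm-increasing u<v)
... | inj₂ eq₁ with ub , va ← ∧-true (u == b) eq₁ with refl ← ==⇒≡ u b ub | refl ← ==⇒≡ v a va = sym (norm-decreasing u<v)

sameEdge⇒norm′ : ∀ {n} {e a : Fin n × Fin n} → Increasing e → sameEdge a e ≡ true → e ≡ norm a
sameEdge⇒norm′ {e = u , v} {a , b} u<v eq with ∨-true ((a == u) ∧ (b == v)) eq
... | inj₁ eq₁ with au , bv ← ∧-true (a == u) eq₁ with refl ← ==⇒≡ a u au | refl ← ==⇒≡ b v bv = sym (norm-increasing u<v)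
... | inj₂ eq₁ with av , bu ← ∧-true (a == v) eq₁ with refl ← ==⇒≡ a v av | refl ← ==⇒≡ b u bu = sym (norm-decreasing u<v)

setEqE⇒⊆ : ∀ {n} (I S : List (Fin n × Fin n)) → (∀ {e} → e ∈ S → Increasing e) → setEqE I S ≡ true →
           ∀ {e} → e ∈ S → e ∈ map norm I
setEqE⇒⊆ I S inc eq e∈S with _ , S⊆I ← ∧-true (all (λ e → memE e S) I) eq
  with a , a∈I , same ← any-true _ I (all-true _ S S⊆I e∈S) =
  subst (_∈ map norm I) (sym (sameEdge⇒norm (inc e∈S) same)) (∈-map⁺ norm a∈I)

setEqE⇒⊇ : ∀ {n} (I S : List (Fin n × Fin n)) → (∀ {e} → e ∈ S → Increasing e) → setEqE I S ≡ true →
           ∀ {e} → e ∈ map norm I → e ∈ S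
setEqE⇒⊇ I S inc eq e∈I with I⊆S , _ ← ∧-true (all (λ e → memE e S) I) eq
  with a , a∈I , refl ← ∈-map⁻ norm e∈I
  with s , s∈S , same ← any-true _ S (all-true _ I I⊆S a∈I) =
  subst (_∈ S) (sameEdge⇒norm′ (inc s∈S) same) s∈S

distinct⇒Unique : ∀ {n k} (φ : Vec (Fin n) k) → distinct φ ≡ true → Unique (toList φ)
distinct⇒Unique []v _ = []
distinct⇒Unique (x ∷v φ) eq with x∉ , dφ ← ∧-true (all (λ y → not (x == y)) (toList φ)) eq =
  All.tabulate (λ { y∈ refl → contra x (all-true _ (toList φ) x∉ y∈) }) ∷ distinct⇒Unique φ dφ
  where
  contra : ∀ y → ¬ (not (y == y) ≡ true)
  contra y eq rewrite ==-refl y with () ← eq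

-- The filter inside `injections` is a private local function; the wildcard in the type of the
-- second lemma stands for its application to xs.
mutual
  ∈injections⇒distinct : ∀ {k n} (φ : Vec (Fin n) k) → φ ∈ injections k n → distinct φ ≡ true
  ∈injections⇒distinct {k} {n} φ φ∈ with allVecs k n | φ∈
  ... | xs | φ∈xs = ∈filter⇒distinct k n φ xs φ∈xs

  ∈filter⇒distinct : ∀ k n (φ : Vec (Fin n) k) xs → φ ∈ _ → distinct φ ≡ true
  ∈filter⇒distinct k n φ [] ()
  ∈filter⇒distinct k n φ (x ∷ xs) φ∈ with distinct x in eq
  ∈filter⇒distinct k n φ (x ∷ xs) (here refl) | true = eq
  ∈filter⇒distinct k n φ (x ∷ xs) (there φ∈) | true = ∈filter⇒distinct k n φ xs φ∈
  ∈filter⇒distinct k n φ (x ∷ xs) φ∈ | false = ∈filter⇒distinct k n φ xs φ∈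

image-path : ∀ {n k} u (φ : Vec (Fin n) k) → map norm (imageE (u ∷v φ) (pathEdges k)) ≡ trail u (toList φ)
image-path {k = k} u φ =
  trans (cong (map norm) (trans (cong (map _) (map-tabulate id _)) (map-tabulate _ _)))
    (trans (map-tabulate _ norm) (tabulate-trail u φ))
  where
  tabulate-trail : ∀ {n k} u (φ : Vec (Fin n) k) →
    tabulate (λ i → norm (lookup (u ∷v φ) (inject₁ i) , lookup φ i)) ≡ trail u (toList φ)
  tabulate-trail u []v = refl
  tabulate-trail u (z ∷v φ) = cong (norm (u , z) ∷_) (tabulate-trail z φ)

lookup-last : ∀ {n k} u (φ : Vec (Fin n) k) → lookup (u ∷v φ) (fromℕ k) ≡ endpoint u (toList φ)
lookup-last u []v = refl
lookup-last u (z ∷v φ) = lookup-last z φ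

image-cycle : ∀ {n k} u (φ : Vec (Fin n) k) →
  map norm (imageE (u ∷v φ) (cycleEdges k)) ≡ norm (endpoint u (toList φ) , u) ∷ trail u (toList φ)
image-cycle u φ = cong₂ _∷_ (cong (λ v → norm (v , u)) (lookup-last u φ)) (image-path u φ)

module _ {n : ℕ} {S : List (Fin n × Fin n)} (S∈ : S ∈ subgraphs n) where

  subgraph-increasing : ∀ {e} → e ∈ S → Increasing e
  subgraph-increasing e∈S = ∈edgeList⇒Increasing (∈sublists⇒⊆ S∈ e∈S)

  -- The test compares edges as sets. It yields a permutation once the image has no repeated edge,
  -- which `trail-unique` and `closed-trail-unique` provide for the two patterns.
  isIso⇒image : ∀ {k} {es : List (Fin k × Fin k)} → isIsoTo (graph k es) S ≡ true →
    ∃ λ φ → Unique (toList φ) × (Unique (map norm (imageE φ es)) → S ↭ map norm (imageE φ es))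
  isIso⇒image {k} {es} iso with φ , φ∈ , same ← any-true _ (injections k n) iso =
    φ , distinct⇒Unique φ (∈injections⇒distinct φ φ∈) ,
    λ !I → unique⊆⇒↭ (∈sublists⇒Unique (edgeList-unique n) S∈) !I
      (setEqE⇒⊆ (imageE φ es) S subgraph-increasing same) (setEqE⇒⊇ (imageE φ es) S subgraph-increasing same)

  IsPath IsCycle : ℕ → Set
  IsPath k = ∃₂ λ u s → length s ≡ k × Unique (u ∷ s) × S ↭ trail u s
  IsCycle k = ∃₂ λ u s → length s ≡ k × Unique (u ∷ s) × S ↭ norm (endpoint u s , u) ∷ trail u s

  isIsoTo-P : ∀ {k} → isIsoTo (P (suc k)) S ≡ true → IsPath k
  isIsoTo-P {k} iso with u ∷v φ , !φ , S↭ ← isIso⇒image {es = pathEdges k} iso =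
    u , toList φ , length-toList φ , !φ ,
    subst (S ↭_) (image-path u φ) (S↭ (subst Unique (sym (image-path u φ)) (trail-unique !φ)))

  isIsoTo-C : ∀ {k} → isIsoTo (C (3 + k)) S ≡ true → IsCycle (2 + k)
  isIsoTo-C {k} iso with u ∷v y ∷v z ∷v φ , !φ , S↭ ← isIso⇒image {es = cycleEdges (2 + k)} iso =
    u , y ∷ z ∷ toList φ , cong (2 +_) (length-toList φ) , !φ ,
    subst (S ↭_) (image-cycle u (y ∷v z ∷v φ)) (S↭ (subst Unique (sym (image-cycle u (y ∷v z ∷v φ))) (closed-trail-unique !φ)))

  module _ {p q : Fin n} (pq∈S : norm (p , q) ∈ S) where

    private
      arms-length : ∀ {k} {u a b : Fin n} {s} A B → u ∷ s ↭ a ∷ b ∷ A ++ B → length s ≡ suc k → length A + length B ≡ k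
      arms-length A B v↭ eq = suc-injective (trans (cong suc (sym (length-++ A))) (trans (sym (suc-injective (↭-length v↭))) eq))

    path-split : ∀ {k} → IsPath (suc k) → ∃₂ λ s t → length s + length t ≡ k × PathSplit p q S s t
    path-split {k} (u , s , len , !us , S↭) with ts ← trail-split (∈-resp-↭ S↭ pq∈S) = orient (norm-injective e≡)
      where
      open TrailSplit ts
      split : PathSplit a b S A B
      split = ↭-trans S↭ edges↭ , Unique-resp-↭ vertices↭ !us
      lens = arms-length A B vertices↭ len
      orient : (p , q) ≡ (a , b) ⊎ (p , q) ≡ (b , a) → ∃₂ λ s t → length s + length t ≡ k × PathSplit p q S s t
      orient (inj₁ refl) = A , B , lens , split
      orient (inj₂ refl) = B , A , trans (+-comm (length B) _) lens , PathSplit-swap A B split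

    cycle-split : ∀ {k} → IsCycle (suc k) → ∃₂ λ s t → length s + length t ≡ k × CycleSplit p q S s t
    cycle-split {k} (u , s , len , !us , S↭) with ∈-resp-↭ S↭ pq∈S
    ... | there pq∈ with ts ← trail-split pq∈ = orient (norm-injective e≡)
      where
      open TrailSplit ts
      split : CycleSplit a b S A B
      split = ↭-trans S↭ (↭-trans (prep _ edges↭) (↭-trans (swap _ _ ↭-refl)
                (↭-reflexive (cong (λ f → norm (a , b) ∷ f ∷ trail a A ++ trail b B)
                  (trans (norm-swap (endpoint u s) u) (cong₂ (λ v w → norm (v , w)) (sym A-end) (sym B-end)))))))
            , Unique-resp-↭ vertices↭ !us
      lens = arms-length A B vertices↭ len
      orient : (p , q) ≡ (a , b) ⊎ (p , q) ≡ (b , a) → ∃₂ λ s t → length s + length t ≡ k × CycleSplit p q S s t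
      orient (inj₁ refl) = A , B , lens , split
      orient (inj₂ refl) = B , A , trans (+-comm (length B) _) lens , CycleSplit-swap A B split
    -- If {p,q} is the closing edge itself, one arm is empty and the last edge of the trail takes
    -- over as closing edge.
    cycle-split {k} (u , s , len , !us , S↭) | here pq≡ with initLast s
    ... | s′ ∷ʳ′ l = orient (norm-injective (trans pq≡ (trans (cong (λ v → norm (v , u)) (endpoint-∷ʳ u s′ l)) (norm-swap l u))))
      where
      split : CycleSplit u l S s′ []
      split = ↭-trans S↭ (begin
          norm (endpoint u (s′ ∷ʳ l) , u) ∷ trail u (s′ ∷ʳ l)
            ≡⟨ cong₂ (λ v es → norm (v , u) ∷ es) (endpoint-∷ʳ u s′ l) (trail-∷ʳ u s′ l) ⟩
          norm (l , u) ∷ (trail u s′ ∷ʳ norm (endpoint u s′ , l))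
            ≡⟨ cong (_∷ (trail u s′ ∷ʳ norm (endpoint u s′ , l))) (norm-swap l u) ⟩
          norm (u , l) ∷ (trail u s′ ∷ʳ norm (endpoint u s′ , l))
            ↭⟨ prep _ (∷↭∷ʳ (norm (endpoint u s′ , l)) (trail u s′)) ⟨
          norm (u , l) ∷ norm (endpoint u s′ , l) ∷ trail u s′
            ≡⟨ cong (λ es → norm (u , l) ∷ norm (endpoint u s′ , l) ∷ es) (++-identityʳ (trail u s′)) ⟨
          norm (u , l) ∷ norm (endpoint u s′ , l) ∷ trail u s′ ++ [] ∎)
        , Unique-resp-↭ (prep u (↭-trans (↭-sym (∷↭∷ʳ l s′)) (prep l (↭-reflexive (sym (++-identityʳ s′)))))) !us
        where open PermutationReasoning
      lens : length s′ + 0 ≡ k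
      lens = trans (+-identityʳ _) (suc-injective (trans (↭-length (∷↭∷ʳ l s′)) len))
      orient : (p , q) ≡ (u , l) ⊎ (p , q) ≡ (l , u) → ∃₂ λ s t → length s + length t ≡ k × CycleSplit p q S s t
      orient (inj₁ refl) = s′ , [] , lens , split
      orient (inj₂ refl) = [] , s′ , trans (sym (+-identityʳ _)) lens , CycleSplit-swap s′ [] split

∈edgeList : ∀ {n} (u v : Fin n) → toℕ u < toℕ v → (u , v) ∈ edgeList n
∈edgeList {n} u v u<v = ∈-concatMap⁺ row (Any.map (λ { refl → ∈-concatMap⁺ (cell u) (Any.map (λ { refl → in-cell }) (∈-allFin v)) }) (∈-allFin u))
  where
  in-cell : (u , v) ∈ cell u v
  in-cell rewrite <ᵇ-true u<v = here refl

_≟ᴱ_ : ∀ {n} → DecidableEquality (Fin n × Fin n)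
_≟ᴱ_ = ≡-dec Fin._≟_ Fin._≟_

module _ {n : ℕ} where
  open import Data.List.Membership.DecPropositional (_≟ᴱ_ {n}) using (_∈?_) public

-- Monomials and their increments

module _ {A : Set} where

  ∏ : List A → (A → ℕ) → ℕ
  ∏ S w = product (map w S)

  ∏-++ : ∀ S T (w : A → ℕ) → ∏ (S ++ T) w ≡ ∏ S w * ∏ T w
  ∏-++ [] T w = sym (+-identityʳ _)
  ∏-++ (x ∷ S) T w = trans (cong (w x *_) (∏-++ S T w)) (sym (*-assoc (w x) _ _))

  ∏-↭ : ∀ {S T} (w : A → ℕ) → S ↭ T → ∏ S w ≡ ∏ T w
  ∏-↭ w S↭T = product-↭ (↭.map⁺ w S↭T)

  ∏-mono : ∀ S {w w′ : A → ℕ} → (∀ {e} → e ∈ S → w e ≤ w′ e) → ∏ S w ≤ ∏ S w′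
  ∏-mono [] _ = ≤-refl
  ∏-mono (x ∷ S) w≤w′ = *-mono-≤ (w≤w′ (here refl)) (∏-mono S (w≤w′ ∘ there))

  ∏-cong : ∀ S {w w′ : A → ℕ} → (∀ {e} → e ∈ S → w e ≡ w′ e) → ∏ S w ≡ ∏ S w′
  ∏-cong [] _ = refl
  ∏-cong (x ∷ S) w≡w′ = cong₂ _*_ (w≡w′ (here refl)) (∏-cong S (w≡w′ ∘ there))

module Bump {A : Set} (_≟_ : DecidableEquality A) where

  bump : A → (A → ℕ) → A → ℕ
  bump f v e = if does (e ≟ f) then suc (v e) else v e

  bump-same : ∀ f v → bump f v f ≡ suc (v f)
  bump-same f v with f ≟ f
  ... | yes _ = refl
  ... | no f≢f = ⊥-elim (f≢f refl)

  bump-other : ∀ {f e} v → e ≢ f → bump f v e ≡ v e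
  bump-other {f} {e} v e≢f with e ≟ f
  ... | yes e≡f = ⊥-elim (e≢f e≡f)
  ... | no _ = refl

  ≤bump : ∀ f v e → v e ≤ bump f v e
  ≤bump f v e with e ≟ f
  ... | yes _ = n≤1+n _
  ... | no _ = ≤-refl

  -- On a squarefree monomial this unit increment is the exact partial derivative: `Δ-∈` and `Δ-∉`
  -- show that it removes the factor `f` or vanishes. Raising a weight never lowers a product, so
  -- the truncated subtraction loses nothing.
  Δ : A → (A → ℕ) → List A → ℕ
  Δ f v S = ∏ S (bump f v) ∸ ∏ S v

  ∏-bump : ∀ f v S → ∏ S (bump f v) ≡ ∏ S v + Δ f v S
  ∏-bump f v S = sym (m+[n∸m]≡n (∏-mono S (λ {e} _ → ≤bump f v e)))

  Δ-∉ : ∀ {f v S} → f ∉ S → Δ f v S ≡ 0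
  Δ-∉ {f} {v} {S} f∉S = trans (cong (_∸ ∏ S v) (∏-cong S (λ e∈S → bump-other v (λ { refl → f∉S e∈S })))) (n∸n≡0 (∏ S v))

  Δ-∈ : ∀ {f v S T} → Unique S → S ↭ f ∷ T → Δ f v S ≡ ∏ T v
  Δ-∈ {f} {v} {S} {T} !S S↭ = begin
    ∏ S (bump f v) ∸ ∏ S v                        ≡⟨ cong₂ _∸_ (∏-↭ (bump f v) S↭) (∏-↭ v S↭) ⟩
    bump f v f * ∏ T (bump f v) ∸ v f * ∏ T v     ≡⟨ cong₂ (λ a b → a * b ∸ v f * ∏ T v) (bump-same f v) (∏-cong T (λ e∈T → bump-other v (λ { refl → f∉T e∈T }))) ⟩
    ∏ T v + v f * ∏ T v ∸ v f * ∏ T v             ≡⟨ m+n∸n≡m (∏ T v) (v f * ∏ T v) ⟩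
    ∏ T v ∎
    where
    open ≡-Reasoning
    f∉T : f ∉ T
    f∉T f∈T = All.lookup (AllPairs.head (Unique-resp-↭ S↭ !S)) f∈T refl

-- Edge weights as a symmetric function of two vertices

module EdgeWeights {n : ℕ} (v : Fin n × Fin n → ℕ) where
  open Bump (_≟ᴱ_ {n}) public

  directed : Fin n → Fin n → ℕ
  directed i j = if toℕ i <ᵇ toℕ j then v (i , j) else 0

  -- At most one of the summands is nonzero, and on the diagonal both vanish.
  ω : Fin n → Fin n → ℕ
  ω i j = directed i j + directed j i

  ω-sym : ∀ i j → ω i j ≡ ω j i
  ω-sym i j = +-comm (directed i j) (directed j i)

  directed-< : ∀ {i j} → toℕ i < toℕ j → directed i j ≡ v (i , j)
  directed-< i<j rewrite <ᵇ-true i<j = refl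

  directed-≥ : ∀ {i j} → toℕ j ≤ toℕ i → directed i j ≡ 0
  directed-≥ {i} {j} j≤i rewrite <ᵇ-false {toℕ i} {toℕ j} j≤i = refl

  ω-increasing : ∀ {i j} → toℕ i < toℕ j → ω i j ≡ v (i , j)
  ω-increasing i<j = trans (cong₂ _+_ (directed-< i<j) (directed-≥ (<⇒≤ i<j))) (+-identityʳ _)

  ω-norm : ∀ i j → Increasing (norm (i , j)) → v (norm (i , j)) ≡ ω i j
  ω-norm i j inc with norm-cases i j
  ... | inj₁ eq rewrite eq = sym (ω-increasing inc)
  ... | inj₂ eq rewrite eq = trans (sym (ω-increasing inc)) (ω-sym j i)

  ω-bound : ∀ {c} → (∀ {e} → e ∈ edgeList n → v e ≤ c) → ∀ i j → ω i j ≤ c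
  ω-bound v≤c i j with <-cmp (toℕ i) (toℕ j)
  ... | tri< i<j _ _ = ≤-trans (≤-reflexive (ω-increasing i<j)) (v≤c (∈edgeList i j i<j))
  ... | tri> _ _ j<i = ≤-trans (≤-reflexive (trans (ω-sym i j) (ω-increasing j<i))) (v≤c (∈edgeList j i j<i))
  ... | tri≈ _ i≡j _ = ≤-trans (≤-reflexive (cong₂ _+_ (directed-≥ (≤-reflexive (sym i≡j))) (directed-≥ (≤-reflexive i≡j)))) z≤n

  open WeightedGraph ω ω-sym public
  open Walks ω ω-sym public

  ∑-directed : ∀ U → ∑ U (λ i → ∑ U (directed i)) ≡ mass U
  ∑-directed [] = refl
  ∑-directed (u ∷ U) = begin
    directed u u + ∑ U (directed u) + ∑ U (λ i → directed i u + ∑ U (directed i))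
      ≡⟨ cong₂ (λ a b → a + ∑ U (directed u) + b) (directed-≥ {u} ≤-refl) (∑-+ U (λ i → directed i u) (λ i → ∑ U (directed i))) ⟩
    ∑ U (directed u) + (∑ U (λ i → directed i u) + ∑ U (λ i → ∑ U (directed i)))
      ≡⟨ +-assoc (∑ U (directed u)) _ _ ⟨
    ∑ U (directed u) + ∑ U (λ i → directed i u) + ∑ U (λ i → ∑ U (directed i))
      ≡⟨ cong₂ _+_ (sym (∑-+ U (directed u) (λ i → directed i u))) (∑-directed U) ⟩
    star u U + mass U ∎
    where open ≡-Reasoning

  ∑-edgeList : ∑ (edgeList n) v ≡ mass (allFin n)
  ∑-edgeList = trans (trans (∑-concatMap row (allFin n) v) (∑-cong (allFin n) (λ {i} _ →
    trans (∑-concatMap (cell i) (allFin n) v) (∑-cong (allFin n) (λ {j} _ → ∑-cell i j))))) (∑-directed (allFin n))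
    where
    ∑-cell : ∀ i j → ∑ (cell i j) v ≡ directed i j
    ∑-cell i j with toℕ i <ᵇ toℕ j
    ... | true = +-identityʳ _
    ... | false = refl

  ∏-trail : ∀ u s → (∀ {e} → e ∈ trail u s → Increasing e) → ∏ (trail u s) v ≡ walk u s
  ∏-trail u [] _ = refl
  ∏-trail u (z ∷ s) inc = cong₂ _*_ (ω-norm u z (inc (here refl))) (∏-trail z s (inc ∘ there))

  -- The initial budget: an edge is xy itself, joins `x` or `y` to `U`, or lies inside `U`.
  all-but-two : ∀ {x y : Fin n} → toℕ x < toℕ y →
    ∃ λ U → v (x , y) + star x U + star y U + mass U ≡ ∑ (edgeList n) v × (∀ {z} → z ≢ x → z ≢ y → z ∈ U)
  all-but-two {x} {y} x<y with picks-complete (∈-allFin x)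
  ... | U₁ , xU₁∈ , keep₁ with picks-complete (keep₁ (∈-allFin y) (λ { refl → <-irrefl refl x<y }))
  ...   | U , yU∈ , keep = U , budget , λ z≢x z≢y → keep (keep₁ (∈-allFin _) z≢x) z≢y
    where
    open ≡-Reasoning
    budget : v (x , y) + star x U + star y U + mass U ≡ ∑ (edgeList n) v
    budget = begin
      v (x , y) + star x U + star y U + mass U   ≡⟨ cong (λ a → a + star x U + star y U + mass U) (ω-increasing x<y) ⟨
      ω x y + star x U + star y U + mass U       ≡⟨ +-assoc (ω x y + star x U) (star y U) (mass U) ⟩
      ω x y + star x U + (star y U + mass U)     ≡⟨ cong₂ _+_ (star-picks U₁ yU∈ x) (mass-picks U₁ yU∈) ⟨
      star x U₁ + mass U₁                        ≡⟨ mass-picks (allFin n) xU₁∈ ⟨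
      mass (allFin n)                            ≡⟨ ∑-edgeList ⟨
      ∑ (edgeList n) v ∎

  -- The derivative at the heaviest edge

  module Derivative {x y : Fin n} (x<y : toℕ x < toℕ y) {U : List (Fin n)}
    (budget : v (x , y) + star x U + star y U + mass U ≡ ∑ (edgeList n) v) (U-complete : ∀ {z} → z ≢ x → z ≢ y → z ∈ U) where

    f : Fin n × Fin n
    f = x , y

    -- In the application `v` is an optimal weighting with one unit taken off `f`; the successors
    -- restore the weight of `f` and the total of that optimum.
    c N : ℕ
    c = suc (v f)
    N = suc (∑ (edgeList n) v)

    U-budget : c + star x U + star y U + mass U ≡ N
    U-budget = cong suc budget

    arms-∈ : ∀ {s t} → Unique (x ∷ y ∷ s ++ t) → (s , t) ∈ armPairs (length s) (length t) U
    arms-∈ {s} {t} (x∉ ∷ y∉ ∷ !st) = armPairs-complete (proj₁ (Unique-++⁻ s !st)) (proj₁ (proj₂ (Unique-++⁻ s !st)))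
      (proj₂ (proj₂ (Unique-++⁻ s !st))) (λ z∈ → inU (∈-++⁺ˡ z∈)) (λ z∈ → inU (∈-++⁺ʳ s z∈))
      where
      inU : ∀ {z} → z ∈ s ++ t → z ∈ U
      inU z∈ = U-complete (λ { refl → All.lookup x∉ (there z∈) refl }) (λ { refl → All.lookup y∉ z∈ refl })
      Unique-++⁻ : ∀ s {t : List (Fin n)} → Unique (s ++ t) → Unique s × Unique t × (∀ {z} → z ∈ s → z ∉ t)
      Unique-++⁻ [] !t = [] , !t , λ ()
      Unique-++⁻ (a ∷ s) (a∉ ∷ !st) with !s , !t , s∉t ← Unique-++⁻ s !st =
        All.tabulate (λ z∈s → All.lookup a∉ (∈-++⁺ˡ z∈s)) ∷ !s , !t ,
        λ { (here refl) z∈t → All.lookup a∉ (∈-++⁺ʳ s z∈t) refl ; (there z∈s) z∈t → s∉t z∈s z∈t }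

    pathTrails cycleTrails : List (Fin n) × List (Fin n) → List (Fin n × Fin n)
    pathTrails (s , t) = norm f ∷ trail x s ++ trail y t
    cycleTrails (s , t) = norm f ∷ norm (endpoint x s , endpoint y t) ∷ trail x s ++ trail y t

    subgraph-determined : ∀ {S S′ T} → S ∈ subgraphs n → S′ ∈ subgraphs n → S ↭ T → S′ ↭ T → S ≡ S′
    subgraph-determined S∈ S′∈ S↭ S′↭ = sublists-ext (edgeList-unique n) S∈ S′∈
      (∈-resp-↭ (↭-trans S↭ (↭-sym S′↭))) (∈-resp-↭ (↭-trans S′↭ (↭-sym S↭)))

    module _ {S : List (Fin n × Fin n)} (S∈ : S ∈ subgraphs n) where

      private
        Δ-norm : ∀ {T} → S ↭ norm f ∷ T → Δ f v S ≡ ∏ T v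
        Δ-norm {T} S↭ = Δ-∈ (∈sublists⇒Unique (edgeList-unique n) S∈) (subst (λ e → S ↭ e ∷ T) (norm-increasing x<y) S↭)

        increasing : ∀ {T} → S ↭ T → ∀ {e} → e ∈ T → Increasing e
        increasing S↭ e∈ = subgraph-increasing S∈ (∈-resp-↭ (↭-sym S↭) e∈)

        ∏-trails : ∀ s t → (∀ {e} → e ∈ trail x s ++ trail y t → Increasing e) →
                   ∏ (trail x s ++ trail y t) v ≡ pathWeight x y (s , t)
        ∏-trails s t inc = trans (∏-++ (trail x s) (trail y t) v)
          (cong₂ _*_ (∏-trail x s (inc ∘ ∈-++⁺ˡ)) (∏-trail y t (inc ∘ ∈-++⁺ʳ (trail x s))))

      Δ-path : ∀ s t → S ↭ pathTrails (s , t) → Δ f v S ≡ pathWeight x y (s , t)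
      Δ-path s t S↭ = trans (Δ-norm S↭) (∏-trails s t (increasing S↭ ∘ there))

      Δ-cycle : ∀ s t → S ↭ cycleTrails (s , t) → Δ f v S ≡ cycleWeight x y (s , t)
      Δ-cycle s t S↭ = trans (Δ-norm S↭) (trans
        (cong₂ _*_ (ω-norm (endpoint x s) (endpoint y t) (increasing S↭ (there (here refl)))) (∏-trails s t (increasing S↭ ∘ there ∘ there)))
        (*-comm (ω (endpoint x s) (endpoint y t)) (pathWeight x y (s , t))))

    ΔC ΔP : ℕ → List (Fin n × Fin n) → ℕ
    ΔC m S = if isIsoTo (C m) S then Δ f v S else 0
    ΔP k S = if isIsoTo (P k) S then Δ f v S else 0

    -- For short first arms the roles of the two arms are exchanged, so that the arm chosen last
    -- always has at least two edges.
    pairsAt : ℕ → ℕ → List (List (Fin n) × List (Fin n))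
    pairsAt i@(suc (suc _)) j = armPairs i j U
    pairsAt i j = map Product.swap (armPairs j i U)

    pairsAt-complete : ∀ {s t} → Unique (x ∷ y ∷ s ++ t) → (s , t) ∈ pairsAt (length s) (length t)
    pairsAt-complete {s@(_ ∷ _ ∷ _)} !v = arms-∈ !v
    pairsAt-complete {s@[]} {t} !v = ∈-map⁺ Product.swap (arms-∈ {t} {s} (Unique-resp-↭ (prep x (prep y (++-comm s t))) !v))
    pairsAt-complete {s@(_ ∷ [])} {t} !v = ∈-map⁺ Product.swap (arms-∈ {t} {s} (Unique-resp-↭ (prep x (prep y (++-comm s t))) !v))

    -- Subgraphs that avoid `f` have increment zero. Any other one can be rebuilt from its pair of
    -- arms through `T`, so distinct subgraphs use distinct pairs.
    dominate : ∀ {B : Set} (H : Graph) (M : List B) (g : B → ℕ) (T : B → List (Fin n × Fin n)) →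
      (∀ {S} → S ∈ subgraphs n → f ∈ S → isIsoTo H S ≡ true → ∃ λ b → b ∈ M × S ↭ T b × Δ f v S ≡ g b) →
      ∑ (subgraphs n) (λ S → if isIsoTo H S then Δ f v S else 0) ≤ ∑ M g
    dominate H M g T witness = ∑-dominate (subgraphs n) M _ g (λ S b → S ↭ T b) (sublists-unique (edgeList-unique n))
      subgraph-determined found
      where
      found : ∀ {S} → S ∈ subgraphs n → (if isIsoTo H S then Δ f v S else 0) ≡ 0 ⊎
              ∃ λ b → b ∈ M × S ↭ T b × (if isIsoTo H S then Δ f v S else 0) ≤ g b
      found {S} S∈ with isIsoTo H S in iso | f ∈? S
      ... | false | _ = inj₁ refl
      ... | true | no f∉S = inj₁ (Δ-∉ f∉S)
      ... | true | yes f∈S with b , b∈M , S↭ , Δ≡ ← witness S∈ f∈S iso = inj₂ (b , b∈M , S↭ , ≤-reflexive Δ≡)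

    norm-f∈ : ∀ {S} → f ∈ S → norm f ∈ S
    norm-f∈ {S} = subst (_∈ S) (sym (norm-increasing x<y))

    cycleWeight-swap : ∀ s t → cycleWeight x y (s , t) ≡ cycleWeight y x (t , s)
    cycleWeight-swap s t = cong₂ _*_ (*-comm (walk x s) (walk y t)) (ω-sym (endpoint x s) (endpoint y t))

    cycles≤ : ∀ i j → ∑ (subgraphs n) (ΔC (3 + (i + j))) ≤ ∑ (armPairs (1 + i) j U) (cycleWeight x y)
    cycles≤ i j = dominate (C (3 + (i + j))) (armPairs (1 + i) j U) (cycleWeight x y) cycleTrails
      (λ S∈ f∈S iso → witness S∈ (cycle-split S∈ (norm-f∈ f∈S) (isIsoTo-C S∈ iso)))
      where
      witness : ∀ {S} → S ∈ subgraphs n → (∃₂ λ s t → length s + length t ≡ 1 + (i + j) × CycleSplit x y S s t) →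
                ∃ λ b → b ∈ armPairs (1 + i) j U × S ↭ cycleTrails b × Δ f v S ≡ cycleWeight x y b
      witness S∈ (s , t , len , split) with CycleSplit-anywhere s t (1 + i) j len split
      ... | s , t , s≡ , t≡ , S↭ , !v =
        (s , t) , subst₂ (λ a b → (s , t) ∈ armPairs a b U) s≡ t≡ (arms-∈ !v) , S↭ , Δ-cycle S∈ s t S↭

    -- The version with `x` and `y` exchanged, for the positions at which `pairsAt` swaps the arms.
    cycles≤′ : ∀ i j → ∑ (subgraphs n) (ΔC (3 + (i + j))) ≤ ∑ (armPairs (1 + i) j U) (cycleWeight y x)
    cycles≤′ i j = dominate (C (3 + (i + j))) (armPairs (1 + i) j U) (cycleWeight y x) (cycleTrails ∘ Product.swap)
      (λ S∈ f∈S iso → witness S∈ (cycle-split S∈ (norm-f∈ f∈S) (isIsoTo-C S∈ iso)))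
      where
      witness : ∀ {S} → S ∈ subgraphs n → (∃₂ λ s t → length s + length t ≡ 1 + (i + j) × CycleSplit x y S s t) →
                ∃ λ b → b ∈ armPairs (1 + i) j U × S ↭ cycleTrails (Product.swap b) × Δ f v S ≡ cycleWeight y x b
      witness S∈ (s , t , len , split) with CycleSplit-anywhere s t j (1 + i) (trans len (+-comm (1 + i) j)) split
      ... | s , t , s≡ , t≡ , S↭ , !v =
        (t , s) , subst₂ (λ a b → (t , s) ∈ armPairs a b U) t≡ s≡ (arms-∈ (Unique-resp-↭ (prep x (prep y (++-comm s t))) !v))
        , S↭ , trans (Δ-cycle S∈ s t S↭) (cycleWeight-swap s t)

    module _ (l : ℕ) (is : List ℕ) (is-complete : ∀ {i} → i ≤ l → i ∈ is) where

      allPairs : List (List (Fin n) × List (Fin n))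
      allPairs = concatMap (λ i → pairsAt i (l ∸ i)) is

      allPairs-complete : ∀ s t → length s + length t ≡ l → Unique (x ∷ y ∷ s ++ t) → (s , t) ∈ allPairs
      allPairs-complete s t refl !v = ∈-concatMap⁺ (λ i → pairsAt i (l ∸ i)) (Any.map here-it (is-complete (m≤m+n (length s) (length t))))
        where
        here-it : ∀ {i} → length s ≡ i → (s , t) ∈ pairsAt i (l ∸ i)
        here-it refl = subst (λ j → (s , t) ∈ pairsAt (length s) j) (sym (m+n∸m≡n (length s) (length t))) (pairsAt-complete !v)

      -- Since `f` has its own position on each path, all positions are pooled into one list before
      -- the comparison; cycles are instead compared afresh at each position.
      paths≤ : ∑ (subgraphs n) (ΔP (2 + l)) ≤ ∑ is (λ i → ∑ (pairsAt i (l ∸ i)) (pathWeight x y))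
      paths≤ = ≤-trans
        (dominate (P (2 + l)) allPairs (pathWeight x y) pathTrails
          (λ S∈ f∈S iso → witness S∈ (path-split S∈ (norm-f∈ f∈S) (isIsoTo-P S∈ iso))))
        (≤-reflexive (∑-concatMap (λ i → pairsAt i (l ∸ i)) is (pathWeight x y)))
        where
        witness : ∀ {S} → S ∈ subgraphs n → (∃₂ λ s t → length s + length t ≡ l × PathSplit x y S s t) →
                  ∃ λ b → b ∈ allPairs × S ↭ pathTrails b × Δ f v S ≡ pathWeight x y b
        witness S∈ (s , t , len , S↭ , !v) = (s , t) , allPairs-complete s t len !v , S↭ , Δ-path S∈ s t S↭

    module _ (v≤c : ∀ {e} → e ∈ edgeList n → v e ≤ c) where

      -- The share of a single position of `f`, with l = m - 1. All cycles enter it in full, with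
      -- coefficient 2.
      Bound : ℕ → ℕ → Set
      Bound l X = (2 * ∑ (subgraphs n) (ΔC (suc l)) + X) * suc l ^ l * 1000 ≤ 2692 * N ^ l

      bound₁ : ∀ i j → Bound (2 + (i + j)) (∑ (armPairs (2 + i) j U) (pathWeight x y))
      bound₁ i j = ≤-trans
        (*-monoˡ-≤ 1000 (*-monoˡ-≤ ((3 + (i + j)) ^ (2 + (i + j))) (+-monoˡ-≤ _ (*-monoʳ-≤ 2 (cycles≤ i j)))))
        (armPairs-bound (ω-bound v≤c) x y U i j (≤-reflexive U-budget))

      bound₂ : ∀ i j → Bound (2 + (i + j)) (∑ (map Product.swap (armPairs (2 + i) j U)) (pathWeight x y))
      bound₂ i j = ≤-trans
        (*-monoˡ-≤ 1000 (*-monoˡ-≤ ((3 + (i + j)) ^ (2 + (i + j))) (+-mono-≤ (*-monoʳ-≤ 2 (cycles≤′ i j))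
          (≤-reflexive (trans (∑-map Product.swap (armPairs (2 + i) j U) (pathWeight x y))
            (∑-cong (armPairs (2 + i) j U) (λ {(t , s)} _ → *-comm (walk x s) (walk y t))))))))
        (armPairs-bound (ω-bound v≤c) y x U i j (≤-reflexive (trans (cong (_+ mass U) (lem c (star y U) (star x U))) U-budget)))
        where
        lem : ∀ a b c → a + b + c ≡ a + c + b
        lem = solve-∀

      -- As i + j ≥ 4, one of the arms has the two edges that `closings` consumes; for i < 2 it is
      -- the other arm, handled by `bound₂`.
      bound : ∀ i j → 4 ≤ i + j → Bound (i + j) (∑ (pairsAt i j) (pathWeight x y))
      bound (suc (suc i)) j _ = bound₁ i j
      bound zero (suc (suc j)) _ = subst (λ k → Bound (2 + k) (∑ (pairsAt 0 (2 + j)) (pathWeight x y))) (+-identityʳ j) (bound₂ j 0)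
      bound (suc zero) (suc (suc j)) _ =
        subst (λ k → Bound (2 + k) (∑ (pairsAt 1 (2 + j)) (pathWeight x y))) (+-comm j 1) (bound₂ j 1)
      bound zero zero ()
      bound zero (suc zero) (s≤s ())
      bound (suc zero) zero (s≤s ())
      bound (suc zero) (suc zero) (s≤s (s≤s ()))

      derivative-bound : ∀ {l m k} → 4 ≤ l → m ≡ suc l → k ≡ 2 + l →
        (2 * m * ∑ (subgraphs n) (ΔC m) + ∑ (subgraphs n) (ΔP k)) * m ^ l * 1000 ≤ m * (2692 * N ^ l)
      derivative-bound {l} 4≤l refl refl = begin
        (2 * suc l * c′ + ∑ (subgraphs n) (ΔP (2 + l))) * suc l ^ l * 1000
          ≤⟨ *-monoˡ-≤ 1000 (*-monoˡ-≤ (suc l ^ l) (+-monoʳ-≤ (2 * suc l * c′) (paths≤ l is (∈-upTo⁺ ∘ s≤s)))) ⟩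
        (2 * suc l * c′ + ∑ is p′) * suc l ^ l * 1000
          ≡⟨ cong (λ a → (a + ∑ is p′) * suc l ^ l * 1000) (lem (suc l) c′) ⟩
        (suc l * (2 * c′) + ∑ is p′) * suc l ^ l * 1000
          ≡⟨ cong (λ a → (a + ∑ is p′) * suc l ^ l * 1000) (∑-const (2 * c′)) ⟨
        (∑ is (λ _ → 2 * c′) + ∑ is p′) * suc l ^ l * 1000
          ≡⟨ cong (λ a → a * suc l ^ l * 1000) (∑-+ is (λ _ → 2 * c′) p′) ⟨
        ∑ is (λ i → 2 * c′ + p′ i) * suc l ^ l * 1000
          ≡⟨ cong (_* 1000) (∑-*ʳ is (suc l ^ l) (λ i → 2 * c′ + p′ i)) ⟨
        ∑ is (λ i → (2 * c′ + p′ i) * suc l ^ l) * 1000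
          ≡⟨ ∑-*ʳ is 1000 (λ i → (2 * c′ + p′ i) * suc l ^ l) ⟨
        ∑ is (λ i → (2 * c′ + p′ i) * suc l ^ l * 1000)
          ≤⟨ ∑-mono is (λ {i} i∈ → at i (≤-pred (∈-upTo⁻ i∈))) ⟩
        ∑ is (λ _ → 2692 * N ^ l)
          ≡⟨ ∑-const (2692 * N ^ l) ⟩
        suc l * (2692 * N ^ l) ∎
        where
        open ≤-Reasoning
        is = upTo (suc l)
        c′ = ∑ (subgraphs n) (ΔC (suc l))
        p′ : ℕ → ℕ
        p′ i = ∑ (pairsAt i (l ∸ i)) (pathWeight x y)
        lem : ∀ m c → 2 * m * c ≡ m * (2 * c)
        lem = solve-∀
        ∑-const : ∀ a → ∑ is (λ _ → a) ≡ suc l * a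
        ∑-const a = trans (go is) (cong (_* a) (length-upTo (suc l)))
          where
          go : ∀ (xs : List ℕ) → ∑ xs (λ _ → a) ≡ length xs * a
          go [] = refl
          go (_ ∷ xs) = cong (a +_) (go xs)
        at : ∀ i → i ≤ l → (2 * c′ + p′ i) * suc l ^ l * 1000 ≤ 2692 * N ^ l
        at i i≤l = subst (λ k → Bound k (p′ i)) (m+[n∸m]≡n i≤l) (bound i (l ∸ i) (≤-trans 4≤l (≤-reflexive (sym (m+[n∸m]≡n i≤l)))))

module _ {A : Set} where

  ∑-zero : ∀ (xs : List A) {f : A → ℕ} → (∀ {x} → x ∈ xs → f x ≡ 0) → ∑ xs f ≡ 0
  ∑-zero [] _ = refl
  ∑-zero (x ∷ xs) f≡0 = cong₂ _+_ (f≡0 (here refl)) (∑-zero xs (f≡0 ∘ there))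

  ∑-indicator : ∀ {xs : List A} {x} {δ : A → ℕ} → Unique xs → x ∈ xs → δ x ≡ 1 → (∀ {y} → y ≢ x → δ y ≡ 0) → ∑ xs δ ≡ 1
  ∑-indicator {x ∷ xs} (x∉ ∷ _) (here refl) δ₁ δ₀ = cong₂ _+_ δ₁ (∑-zero xs (λ y∈ → δ₀ (λ { refl → All.lookup x∉ y∈ refl })))
  ∑-indicator {x ∷ xs} (x∉ ∷ !xs) (there z∈) δ₁ δ₀ = cong₂ _+_ (δ₀ (All.lookup x∉ z∈)) (∑-indicator !xs z∈ δ₁ δ₀)

  ∑-member : ∀ {xs : List A} {x} (f : A → ℕ) → x ∈ xs → f x ≤ ∑ xs f
  ∑-member {x ∷ xs} f (here refl) = m≤m+n (f x) (∑ xs f)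
  ∑-member {x ∷ xs} f (there y∈) = ≤-trans (∑-member f y∈) (m≤n+m (∑ xs f) (f x))

  ∑-max : ∀ (xs : List A) (f : A → ℕ) → 0 < ∑ xs f → ∃ λ x → x ∈ xs × 0 < f x × (∀ {y} → y ∈ xs → f y ≤ f x)
  ∑-max xs f pos with ∑-argmax xs
    where
    ∑-argmax : ∀ xs → xs ≡ [] ⊎ ∃ λ x → x ∈ xs × (∀ {y} → y ∈ xs → f y ≤ f x)
    ∑-argmax [] = inj₁ refl
    ∑-argmax (x ∷ xs) with ∑-argmax xs
    ... | inj₁ refl = inj₂ (x , here refl , λ { (here refl) → ≤-refl })
    ... | inj₂ (y , y∈ , max) with ≤-total (f x) (f y)
    ...   | inj₁ x≤y = inj₂ (y , there y∈ , λ { (here refl) → x≤y ; (there z∈) → max z∈ })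
    ...   | inj₂ y≤x = inj₂ (x , here refl , λ { (here refl) → ≤-refl ; (there z∈) → ≤-trans (max z∈) y≤x })
  ... | inj₁ refl with () ← pos
  ... | inj₂ (x , x∈ , max) = x , x∈ , n≢0⇒n>0 (λ fx≡0 → <⇒≢ pos (sym (∑-zero xs (λ y∈ → n≤0⇒n≡0 (≤-trans (max y∈) (≤-reflexive fx≡0)))))) , max

∑-swap : {A B : Set} (xs : List A) (ys : List B) (f : A → B → ℕ) → ∑ xs (λ x → ∑ ys (f x)) ≡ ∑ ys (λ y → ∑ xs (λ x → f x y))
∑-swap [] ys f = sym (∑-zero ys (λ _ → refl))
∑-swap (x ∷ xs) ys f = trans (cong (∑ ys (f x) +_) (∑-swap xs ys f)) (sym (∑-+ ys (f x) (λ y → ∑ xs (λ x → f x y))))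

-- Optimal integer weights

module Polynomial {A : Set} (_≟_ : DecidableEquality A) {E : List A} (!E : Unique E) (L : List (List A)) (coef : List A → ℕ)
  (L-unique : ∀ {S} → S ∈ L → Unique S) (L-⊆ : ∀ {S} → S ∈ L → ∀ {e} → e ∈ S → e ∈ E) where
  open Bump _≟_

  value : (A → ℕ) → ℕ
  value w = ∑ L (λ S → coef S * ∏ S w)

  derivative : A → (A → ℕ) → ℕ
  derivative f v = ∑ L (λ S → coef S * Δ f v S)

  total : (A → ℕ) → ℕ
  total = ∑ E

  value-mono : ∀ {w w′} → (∀ {e} → e ∈ E → w e ≤ w′ e) → value w ≤ value w′
  value-mono w≤w′ = ∑-mono L (λ {S} S∈ → *-monoʳ-≤ (coef S) (∏-mono S (w≤w′ ∘ L-⊆ S∈)))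

  value-cong : ∀ {w w′} → (∀ e → w e ≡ w′ e) → value w ≡ value w′
  value-cong w≡w′ = ∑-cong L (λ {S} _ → cong (coef S *_) (∏-cong S (λ {e} _ → w≡w′ e)))

  value-bump : ∀ f v → value (bump f v) ≡ value v + derivative f v
  value-bump f v = trans (∑-cong L (λ {S} _ → trans (cong (coef S *_) (∏-bump f v S)) (*-distribˡ-+ (coef S) (∏ S v) (Δ f v S))))
    (∑-+ L (λ S → coef S * ∏ S v) (λ S → coef S * Δ f v S))

  𝟙 : A → A → ℕ
  𝟙 e g = if does (g ≟ e) then 1 else 0

  𝟙-same : ∀ e → 𝟙 e e ≡ 1
  𝟙-same e with e ≟ e
  ... | yes _ = refl
  ... | no e≢e = ⊥-elim (e≢e refl)

  𝟙-other : ∀ {e g} → g ≢ e → 𝟙 e g ≡ 0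
  𝟙-other {e} {g} g≢e with g ≟ e
  ... | yes g≡e = ⊥-elim (g≢e g≡e)
  ... | no _ = refl

  bump-𝟙 : ∀ e v g → bump e v g ≡ v g + 𝟙 e g
  bump-𝟙 e v g with g ≟ e
  ... | yes _ = +-comm 1 (v g)
  ... | no _ = sym (+-identityʳ (v g))

  total-bump : ∀ {f} v → f ∈ E → total (bump f v) ≡ suc (total v)
  total-bump {f} v f∈E = begin
    ∑ E (bump f v)              ≡⟨ ∑-cong E (λ {e} _ → bump-𝟙 f v e) ⟩
    ∑ E (λ e → v e + 𝟙 f e)     ≡⟨ ∑-+ E v (𝟙 f) ⟩
    ∑ E v + ∑ E (𝟙 f)           ≡⟨ cong (∑ E v +_) (∑-indicator !E f∈E (𝟙-same f) 𝟙-other) ⟩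
    ∑ E v + 1                   ≡⟨ +-comm (∑ E v) 1 ⟩
    suc (∑ E v) ∎
    where open ≡-Reasoning

  -- Euler's identity Σ v_e ∂_e = deg for squarefree monomials, in terms of increments.
  euler : ∀ {S} v → Unique S → (∀ {e} → e ∈ S → e ∈ E) → ∑ E (λ e → v e * ∏ S (bump e v)) ≡ (total v + length S) * ∏ S v
  euler {[]} v _ _ = trans (∑-*ʳ E 1 v) (cong (_* 1) (sym (+-identityʳ (total v))))
  euler {g ∷ S} v (g∉S ∷ !S) S⊆E = begin
    ∑ E (λ e → v e * (bump e v g * ∏ S (bump e v)))
      ≡⟨ ∑-cong E (λ {e} _ → term e) ⟩
    ∑ E (λ e → v g * (v e * ∏ S (bump e v)) + v g * ∏ S v * 𝟙 e g)
      ≡⟨ ∑-+ E (λ e → v g * (v e * ∏ S (bump e v))) (λ e → v g * ∏ S v * 𝟙 e g) ⟩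
    ∑ E (λ e → v g * (v e * ∏ S (bump e v))) + ∑ E (λ e → v g * ∏ S v * 𝟙 e g)
      ≡⟨ cong₂ _+_ (trans (∑-*ˡ E (v g) _) (cong (v g *_) (euler v !S (S⊆E ∘ there))))
           (trans (∑-*ˡ E (v g * ∏ S v) _) (cong (v g * ∏ S v *_) (∑-indicator !E (S⊆E (here refl)) (𝟙-same g) (λ e≢g → 𝟙-other (e≢g ∘ sym))))) ⟩
    v g * ((total v + length S) * ∏ S v) + v g * ∏ S v * 1
      ≡⟨ lem (v g) (total v) (length S) (∏ S v) ⟩
    (total v + suc (length S)) * (v g * ∏ S v) ∎
    where
    open ≡-Reasoning
    lem : ∀ a t s p → a * ((t + s) * p) + a * p * 1 ≡ (t + suc s) * (a * p)
    lem = solve-∀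
    -- Product rule: raising `e` changes the factor at `g` only if e = g, and then it adds one
    -- further copy of the monomial.
    term : ∀ e → v e * (bump e v g * ∏ S (bump e v)) ≡ v g * (v e * ∏ S (bump e v)) + v g * ∏ S v * 𝟙 e g
    term e with g ≟ e
    ... | no _ = lem′ (v e) (v g) (∏ S (bump e v)) (∏ S v)
      where
      lem′ : ∀ a b p q → a * (b * p) ≡ b * (a * p) + b * q * 0
      lem′ = solve-∀
    ... | yes refl = trans (lem′ (v g) (∏ S (bump g v))) (cong (λ p → v g * (v g * ∏ S (bump g v)) + v g * p * 1)
            (∏-cong S (λ {e} e∈S → bump-other v (λ { refl → All.lookup g∉S e∈S refl }))))
      where
      lem′ : ∀ a p → a * (suc a * p) ≡ a * (a * p) + a * p * 1
      lem′ = solve-∀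

  unbump : A → (A → ℕ) → A → ℕ
  unbump f w e = if does (e ≟ f) then pred (w e) else w e

  bump-unbump : ∀ {f w} → 0 < w f → ∀ e → bump f (unbump f w) e ≡ w e
  bump-unbump {f} {w} pos e with e ≟ f
  ... | yes refl = suc-pred (w e) {{>-nonZero pos}}
  ... | no _ = refl

  LocalMax : (A → ℕ) → Set
  LocalMax w = ∀ {f e} → f ∈ E → e ∈ E → 0 < w f → value (bump e (unbump f w)) ≤ value w

  improve : ∀ w → LocalMax w ⊎ ∃ λ w′ → total w′ ≡ total w × value w < value w′
  improve w with any? (λ f → any? (λ e → (0 <? w f) ×-dec (value w <? value (bump e (unbump f w)))) E) E
  ... | no none = inj₁ (λ {f} {e} f∈ e∈ pos → ≮⇒≥ (λ better → none (lose f∈ (lose e∈ (pos , better)))))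
  ... | yes some with f , f∈ , some′ ← find some with e , e∈ , pos , better ← find some′ =
    inj₂ (bump e (unbump f w) , same , better)
    where
    same : total (bump e (unbump f w)) ≡ total w
    same = begin
      total (bump e (unbump f w))    ≡⟨ total-bump (unbump f w) e∈ ⟩
      suc (total (unbump f w))       ≡⟨ total-bump (unbump f w) f∈ ⟨
      total (bump f (unbump f w))    ≡⟨ ∑-cong E (λ {g} _ → bump-unbump pos g) ⟩
      total w ∎
      where open ≡-Reasoning

  -- No weight exceeds the total, so `value (λ _ → total w)` bounds every value that can be reached.
  -- Each improvement gains at least one, and `k` is the gain still possible.
  climb : ∀ k w → value (λ _ → total w) ≤ value w + k → ∃ λ w′ → total w′ ≡ total w × value w ≤ value w′ × LocalMax w′
  climb k w enough with improve w
  ... | inj₁ max = w , refl , ≤-refl , max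
  climb zero w enough | inj₂ (w′ , same , better) = ⊥-elim (<⇒≱ better (begin
    value w′                 ≤⟨ value-mono (λ e∈ → ∑-member w′ e∈) ⟩
    value (λ _ → total w′)   ≡⟨ cong (λ N → value (λ _ → N)) same ⟩
    value (λ _ → total w)    ≤⟨ enough ⟩
    value w + 0              ≡⟨ +-identityʳ _ ⟩
    value w ∎))
    where open ≤-Reasoning
  climb (suc k) w enough | inj₂ (w′ , same , better) with climb k w′ (begin
      value (λ _ → total w′)   ≡⟨ cong (λ N → value (λ _ → N)) same ⟩
      value (λ _ → total w)    ≤⟨ enough ⟩
      value w + suc k          ≡⟨ +-suc (value w) k ⟩
      suc (value w) + k        ≤⟨ +-monoˡ-≤ k better ⟩
      value w′ + k ∎)
    where open ≤-Reasoning
  ... | w″ , same′ , ge , max = w″ , trans same′ same , ≤-trans (<⇒≤ better) ge , max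

  -- The optimum satisfies the Lagrange condition up to the discretisation error m - 1.
  lagrange : ∀ {m f v} → (∀ {S} → S ∈ L → coef S ≡ 0 ⊎ m ≤ length S) →
             (∀ {e} → e ∈ E → value (bump e v) ≤ value (bump f v)) →
             m * value (bump f v) ≤ (total v + m) * derivative f v
  lagrange {m} {f} {v} deg max = begin
    m * value (bump f v)             ≡⟨ cong (m *_) (value-bump f v) ⟩
    m * (value v + D)                ≡⟨ *-distribˡ-+ m (value v) D ⟩
    m * value v + m * D              ≤⟨ +-monoˡ-≤ (m * D) (+-cancelˡ-≤ (total v * value v) _ _ main) ⟩
    total v * D + m * D              ≡⟨ *-distribʳ-+ D (total v) m ⟨
    (total v + m) * D ∎
    where
    open ≤-Reasoning
    D = derivative f v
    -- The optimality condition is averaged over all edges e with weights `v e`. Euler's identity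
    -- bounds the average from below; on the other side it is `total v` times the value at the
    -- optimum.
    main : total v * value v + m * value v ≤ total v * value v + total v * D
    main = begin
      total v * value v + m * value v
        ≡⟨ *-distribʳ-+ (value v) (total v) m ⟨
      (total v + m) * value v
        ≡⟨ ∑-*ˡ L (total v + m) _ ⟨
      ∑ L (λ S → (total v + m) * (coef S * ∏ S v))
        ≤⟨ ∑-mono L (λ {S} S∈ → degree-term S S∈ (deg S∈)) ⟩
      ∑ L (λ S → coef S * ∑ E (λ e → v e * ∏ S (bump e v)))
        ≡⟨ ∑-cong L (λ {S} _ → ∑-*ˡ E (coef S) (λ e → v e * ∏ S (bump e v))) ⟨
      ∑ L (λ S → ∑ E (λ e → coef S * (v e * ∏ S (bump e v))))
        ≡⟨ ∑-swap L E (λ S e → coef S * (v e * ∏ S (bump e v))) ⟩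
      ∑ E (λ e → ∑ L (λ S → coef S * (v e * ∏ S (bump e v))))
        ≡⟨ ∑-cong E (λ {e} _ → trans (∑-cong L (λ {S} _ → lem (coef S) (v e) (∏ S (bump e v)))) (∑-*ˡ L (v e) _)) ⟩
      ∑ E (λ e → v e * value (bump e v))
        ≤⟨ ∑-mono E (λ {e} e∈ → *-monoʳ-≤ (v e) (max e∈)) ⟩
      ∑ E (λ e → v e * value (bump f v))
        ≡⟨ ∑-*ʳ E (value (bump f v)) v ⟩
      total v * value (bump f v)
        ≡⟨ cong (total v *_) (value-bump f v) ⟩
      total v * (value v + D)
        ≡⟨ *-distribˡ-+ (total v) (value v) D ⟩
      total v * value v + total v * D ∎
      where
      lem : ∀ a b c → a * (b * c) ≡ b * (a * c)
      lem = solve-∀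
      degree-term : ∀ S → S ∈ L → coef S ≡ 0 ⊎ m ≤ length S →
                    (total v + m) * (coef S * ∏ S v) ≤ coef S * ∑ E (λ e → v e * ∏ S (bump e v))
      degree-term S S∈ (inj₁ coef≡0) rewrite coef≡0 = ≤-reflexive (*-zeroʳ (total v + m))
      degree-term S S∈ (inj₂ m≤S) = begin
        (total v + m) * (coef S * ∏ S v)            ≡⟨ lem (total v + m) (coef S) (∏ S v) ⟩
        coef S * ((total v + m) * ∏ S v)            ≤⟨ *-monoʳ-≤ (coef S) (*-monoˡ-≤ (∏ S v) (+-monoʳ-≤ (total v) m≤S)) ⟩
        coef S * ((total v + length S) * ∏ S v)     ≡⟨ cong (coef S *_) (euler v (L-unique S∈) (L-⊆ S∈)) ⟨
        coef S * ∑ E (λ e → v e * ∏ S (bump e v)) ∎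

-- The cycle and path form on integer weights

module _ {n : ℕ} {S : List (Fin n × Fin n)} (S∈ : S ∈ subgraphs n) where

  length-P : ∀ {j k} → k ≡ suc j → isIsoTo (P k) S ≡ true → length S ≡ j
  length-P refl iso = count (isIsoTo-P S∈ iso)
    where
    count : ∀ {k} → IsPath S∈ k → length S ≡ k
    count (u , s , len , _ , S↭) = trans (↭-length S↭) (trans (length-trail u s) len)

  length-C : ∀ {j m} → m ≡ 3 + j → isIsoTo (C m) S ≡ true → length S ≡ m
  length-C refl iso = count (isIsoTo-C S∈ iso)
    where
    count : ∀ {k} → IsCycle S∈ k → length S ≡ suc k
    count (u , s , len , _ , S↭) = trans (↭-length S↭) (cong suc (trans (length-trail u s) len))

indicator-degree : ∀ k p q {m d} → (p ≡ true → m ≤ d) → (q ≡ true → m ≤ d) →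
                   k * (if p then 1 else 0) + (if q then 1 else 0) ≡ 0 ⊎ m ≤ d
indicator-degree k true q hp hq = inj₂ (hp refl)
indicator-degree k false true hp hq = inj₂ (hq refl)
indicator-degree k false false hp hq = inj₁ (trans (+-identityʳ _) (*-zeroʳ k))

indicator-* : ∀ k p q a → (k * (if p then 1 else 0) + (if q then 1 else 0)) * a ≡ k * (if p then a else 0) + (if q then a else 0)
indicator-* k p q a = trans (*-distribʳ-+ a (k * _) _) (cong₂ _+_ (trans (*-assoc k _ a) (cong (k *_) (scale p))) (scale q))
  where
  scale : ∀ b → (if b then 1 else 0) * a ≡ (if b then a else 0)
  scale true = *-identityˡ a
  scale false = refl

-- The equations keep m, k and d opaque: otherwise comparing types unfolds the isomorphism tests
-- and the literal 26947.
module NatBound (n : ℕ) {l m k : ℕ} (m≡ : m ≡ 3 + l) (k≡ : k ≡ 4 + l) {d : ℕ} (d≡ : d ≡ 26947) where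

  coef : List (Fin n × Fin n) → ℕ
  coef S = 2 * m * (if isIsoTo (C m) S then 1 else 0) + (if isIsoTo (P k) S then 1 else 0)

  open Polynomial (_≟ᴱ_ {n}) (edgeList-unique n) (subgraphs n) coef (∈sublists⇒Unique (edgeList-unique n)) ∈sublists⇒⊆ public
  open Bump (_≟ᴱ_ {n})

  coef-degree : ∀ {S} → S ∈ subgraphs n → coef S ≡ 0 ⊎ m ≤ length S
  coef-degree {S} S∈ = indicator-degree (2 * m) (isIsoTo (C m) S) (isIsoTo (P k) S)
    (λ iso → ≤-reflexive (sym (length-C S∈ m≡ iso))) (λ iso → ≤-reflexive (trans m≡ (sym (length-P S∈ k≡ iso))))

  coef-* : ∀ S a → coef S * a ≡ 2 * m * (if isIsoTo (C m) S then a else 0) + (if isIsoTo (P k) S then a else 0)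
  coef-* S a = indicator-* (2 * m) (isIsoTo (C m) S) (isIsoTo (P k) S) a

  ∑-coef : ∀ (g : List (Fin n × Fin n) → ℕ) → ∑ (subgraphs n) (λ S → coef S * g S) ≡
    2 * m * ∑ (subgraphs n) (λ S → if isIsoTo (C m) S then g S else 0)
      + ∑ (subgraphs n) (λ S → if isIsoTo (P k) S then g S else 0)
  ∑-coef g = trans (∑-cong (subgraphs n) (λ {S} _ → coef-* S (g S)))
    (trans (∑-+ (subgraphs n) _ _) (cong (_+ ∑ (subgraphs n) (λ S → if isIsoTo (P k) S then g S else 0)) (∑-*ˡ (subgraphs n) (2 * m) _)))

  unbump-≤ : ∀ f w e → unbump f w e ≤ w e
  unbump-≤ f w e with e ≟ᴱ f
  ... | yes _ = pred[n]≤n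
  ... | no _ = ≤-refl

  local-max-derivative : ∀ {v : Fin n × Fin n → ℕ} {f} → 2 ≤ l → f ∈ edgeList n → (∀ {e} → e ∈ edgeList n → v e ≤ suc (v f)) →
    derivative f v * m ^ (2 + l) * 1000 ≤ m * (2692 * suc (total v) ^ (2 + l))
  local-max-derivative {v} {f@(x , y)} 2≤l f∈ v≤c = bound (all-but-two x<y)
    where
    open EdgeWeights v hiding (Δ)
    x<y : toℕ x < toℕ y
    x<y = ∈edgeList⇒Increasing f∈
    bound : (∃ λ U → v (x , y) + star x U + star y U + mass U ≡ ∑ (edgeList n) v × (∀ {z} → z ≢ x → z ≢ y → z ∈ U)) →
            derivative f v * m ^ (2 + l) * 1000 ≤ m * (2692 * suc (total v) ^ (2 + l))
    bound (U , budget , U-complete) = ≤-trans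
      (≤-reflexive (cong (λ a → a * m ^ (2 + l) * 1000) (∑-coef (Δ f v))))
      (Derivative.derivative-bound x<y budget U-complete v≤c (s≤s (s≤s 2≤l)) m≡ k≡)

  local-max-bound : ∀ {w} → 2 ≤ l → LocalMax w → 1000 * m ≤ total w →
                    value w * m ^ (2 + l) * 10000 ≤ d * total w ^ suc (2 + l)
  local-max-bound {w} 2≤l max large = at-heaviest (∑-max (edgeList n) w (≤-trans (subst (λ m → 0 < 1000 * m) (sym m≡) (s≤s z≤n)) large))
    where
    open ≤-Reasoning
    N = total w
    M = m ^ (2 + l)
    at-heaviest : (∃ λ f → f ∈ edgeList n × 0 < w f × (∀ {e} → e ∈ edgeList n → w e ≤ w f)) →
                  value w * M * 10000 ≤ d * (N * N ^ (2 + l))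
    at-heaviest (f , f∈ , pos , w≤) = optimum-arithmetic m (value w) M D (total v) N (N ^ (2 + l)) {{subst NonZero (sym m≡) _}} d≡
      lagrange-w
      (≤-trans (local-max-derivative 2≤l f∈ v≤c) (≤-reflexive (cong (λ N → m * (2692 * N ^ (2 + l))) total-v)))
      N+m≤
      where
      v = unbump f w
      D = derivative f v
      w≡ : ∀ e → bump f v e ≡ w e
      w≡ = bump-unbump pos
      value-w : value (bump f v) ≡ value w
      value-w = value-cong w≡
      total-v : suc (total v) ≡ N
      total-v = trans (sym (total-bump v f∈)) (∑-cong (edgeList n) (λ {e} _ → w≡ e))
      lagrange-w : m * value w ≤ (total v + m) * D
      lagrange-w = subst (λ a → m * a ≤ (total v + m) * D) value-w
        (lagrange coef-degree (λ e∈ → ≤-trans (max f∈ e∈ pos) (≤-reflexive (sym value-w))))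
      v≤c : ∀ {e} → e ∈ edgeList n → v e ≤ suc (v f)
      v≤c {e} e∈ = ≤-trans (unbump-≤ f w e) (≤-trans (w≤ e∈) (≤-reflexive (trans (sym (w≡ f)) (bump-same f v))))
      N+m≤ : 1000 * (total v + m) ≤ 1001 * N
      N+m≤ = begin
        1000 * (total v + m)          ≡⟨ *-distribˡ-+ 1000 (total v) m ⟩
        1000 * total v + 1000 * m     ≤⟨ +-mono-≤ (*-monoʳ-≤ 1000 (≤-trans (n≤1+n (total v)) (≤-reflexive total-v))) large ⟩
        1000 * N + N                  ≡⟨ lem N ⟩
        1001 * N ∎
        where
        lem : ∀ N → 1000 * N + N ≡ 1001 * N
        lem = solve-∀

  nat-bound : ∀ w → 2 ≤ l → 1000 * m ≤ total w → value w * m ^ (2 + l) * 10000 ≤ d * total w ^ suc (2 + l)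
  nat-bound w 2≤l large = at-optimum (climb (value (λ _ → total w)) w (m≤n+m _ (value w)))
    where
    open ≤-Reasoning
    at-optimum : (∃ λ w′ → total w′ ≡ total w × value w ≤ value w′ × LocalMax w′) →
                 value w * m ^ (2 + l) * 10000 ≤ d * total w ^ suc (2 + l)
    at-optimum (w′ , same , w≤w′ , max) = begin
      value w * m ^ (2 + l) * 10000      ≤⟨ *-monoˡ-≤ 10000 (*-monoˡ-≤ (m ^ (2 + l)) w≤w′) ⟩
      value w′ * m ^ (2 + l) * 10000     ≤⟨ local-max-bound 2≤l max (≤-trans large (≤-reflexive (sym same))) ⟩
      d * total w′ ^ suc (2 + l)     ≡⟨ cong (λ N → d * N ^ suc (2 + l)) same ⟩
      d * total w ^ suc (2 + l) ∎

-- Clearing denominators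

open import Data.Integer using (+_)

-- The quotient by 1 is reduced through a gcd that is stuck on a variable; rewriting to the explicit
-- fraction lets the lemmas below compute.
ℕtoℚ-mkℚ : ∀ m → ℕtoℚ m ≡ mkℚ (+ m) 0 (Coprime.sym (Coprime.1-coprimeTo m))
ℕtoℚ-mkℚ m = ↥p/↧p≡p (mkℚ (+ m) 0 (Coprime.sym (Coprime.1-coprimeTo m)))

toℚᵘ-ℕtoℚ : ∀ m → toℚᵘ (ℕtoℚ m) ≡ mkℚᵘ (+ m) 0
toℚᵘ-ℕtoℚ m = cong toℚᵘ (ℕtoℚ-mkℚ m)

ℕtoℚ-+ : ∀ a b → ℕtoℚ (a + b) ≡ ℕtoℚ a +ℚ ℕtoℚ b
ℕtoℚ-+ a b rewrite ℕtoℚ-mkℚ a | ℕtoℚ-mkℚ b =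
  cong (_/ 1) (trans (ℤ.pos-+ a b) (sym (cong₂ ℤ._+_ (ℤ.*-identityʳ (+ a)) (ℤ.*-identityʳ (+ b)))))

ℕtoℚ-* : ∀ a b → ℕtoℚ (a * b) ≡ ℕtoℚ a *ℚ ℕtoℚ b
ℕtoℚ-* a b rewrite ℕtoℚ-mkℚ a | ℕtoℚ-mkℚ b = cong (_/ 1) (ℤ.pos-* a b)

ℕtoℚ-injective : ∀ {a b} → ℕtoℚ a ≡ ℕtoℚ b → a ≡ b
ℕtoℚ-injective {a} {b} eq rewrite ℕtoℚ-mkℚ a | ℕtoℚ-mkℚ b with refl ← eq = refl

ℕtoℚ-mono : ∀ {a b} → a ≤ b → ℕtoℚ a ≤ℚ ℕtoℚ b
ℕtoℚ-mono {a} {b} a≤b rewrite ℕtoℚ-mkℚ a | ℕtoℚ-mkℚ b =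
  *≤* (subst₂ ℤ._≤_ (sym (ℤ.*-identityʳ (+ a))) (sym (ℤ.*-identityʳ (+ b))) (ℤ.+≤+ a≤b))

ℕtoℚ-positive : ∀ m → .{{NonZero m}} → Positive (ℕtoℚ m)
ℕtoℚ-positive (suc m) rewrite ℕtoℚ-mkℚ (suc m) = _

clear-denominator : ∀ q → 0ℚ ≤ℚ q → ∀ {N} k → N ≡ k * ↧ₙ q → q *ℚ ℕtoℚ N ≡ ℕtoℚ (ℤ.∣ ↥ q ∣ * k)
clear-denominator (mkℚ (+ a) d c) _ {N} k refl = toℚᵘ-injective (ℚᵘ.≃-trans (toℚᵘ-homo-* (mkℚ (+ a) d c) (ℕtoℚ N))
  (subst₂ (λ p q → mkℚᵘ (+ a) d ℚᵘ.* p ℚᵘ.≃ q) (sym (toℚᵘ-ℕtoℚ N)) (sym (toℚᵘ-ℕtoℚ (a * k))) (*≡* (begin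
    (+ a) ℤ.* (+ (k * suc d)) ℤ.* + 1         ≡⟨ ℤ.*-identityʳ _ ⟩
    (+ a) ℤ.* (+ (k * suc d))                 ≡⟨ ℤ.pos-* a (k * suc d) ⟨
    + (a * (k * suc d))                     ≡⟨ cong +_ (lem a k d) ⟩
    + (a * k * (suc d * 1))               ≡⟨ ℤ.pos-* (a * k) (suc d * 1) ⟩
    (+ (a * k)) ℤ.* (+ (suc d * 1)) ∎))))
  where
  open ≡-Reasoning
  lem : ∀ a k d → a * (k * suc d) ≡ a * k * (suc d * 1)
  lem = solve-∀
clear-denominator (mkℚ ℤ.-[1+ a ] d c) (*≤* ())

module _ {A : Set} where

  sumℚ-scaled : ∀ c (xs : List A) {f : A → ℚ} {g : A → ℕ} → (∀ {x} → x ∈ xs → f x *ℚ c ≡ ℕtoℚ (g x)) →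
                sumℚ (map f xs) *ℚ c ≡ ℕtoℚ (∑ xs g)
  sumℚ-scaled c [] _ = ℚ.*-zeroˡ c
  sumℚ-scaled c (x ∷ xs) {f} {g} f≡g = trans (ℚ.*-distribʳ-+ c (f x) (sumℚ (map f xs)))
    (trans (cong₂ _+ℚ_ (f≡g (here refl)) (sumℚ-scaled c xs (f≡g ∘ there))) (sym (ℕtoℚ-+ (g x) (∑ xs g))))

  prodℚ-scaled : ∀ N (xs : List A) {f : A → ℚ} {g : A → ℕ} → (∀ {x} → x ∈ xs → f x *ℚ ℕtoℚ N ≡ ℕtoℚ (g x)) →
                 prodℚ (map f xs) *ℚ ℕtoℚ (N ^ length xs) ≡ ℕtoℚ (∏ xs g)
  prodℚ-scaled N [] _ = ℚ.*-identityˡ 1ℚ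
  prodℚ-scaled N (x ∷ xs) {f} {g} f≡g = begin
    f x *ℚ p *ℚ ℕtoℚ (N * N ^ length xs)               ≡⟨ cong (f x *ℚ p *ℚ_) (ℕtoℚ-* N (N ^ length xs)) ⟩
    f x *ℚ p *ℚ (ℕtoℚ N *ℚ ℕtoℚ (N ^ length xs))          ≡⟨ interchange (f x) p (ℕtoℚ N) (ℕtoℚ (N ^ length xs)) ⟩
    f x *ℚ ℕtoℚ N *ℚ (p *ℚ ℕtoℚ (N ^ length xs))          ≡⟨ cong₂ _*ℚ_ (f≡g (here refl)) (prodℚ-scaled N xs (f≡g ∘ there)) ⟩
    ℕtoℚ (g x) *ℚ ℕtoℚ (∏ xs g)                           ≡⟨ ℕtoℚ-* (g x) (∏ xs g) ⟨
    ℕtoℚ (g x * ∏ xs g) ∎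
    where
    open ≡-Reasoning
    p = prodℚ (map f xs)
    interchange : ∀ a b c d → a *ℚ b *ℚ (c *ℚ d) ≡ a *ℚ c *ℚ (b *ℚ d)
    interchange = solve 4 (λ a b c d → a :* b :* (c :* d) := a :* c :* (b :* d)) refl
      where open +-*-Solver

if-scaled : ∀ b {q c a} → (b ≡ true → q *ℚ c ≡ ℕtoℚ a) → (if b then q else 0ℚ) *ℚ c ≡ ℕtoℚ (if b then a else 0)
if-scaled true h = h refl
if-scaled false {c = c} _ = ℚ.*-zeroˡ c

-- Homogeneity: all copies of `H` have `k` edges, so one power of `N` clears every monomial.
β-scaled : ∀ {n N k} (μ : Fin n → Fin n → ℚ) (w : Fin n × Fin n → ℕ) (H : Graph) →
           (∀ {e} → e ∈ edgeList n → μ (proj₁ e) (proj₂ e) *ℚ ℕtoℚ N ≡ ℕtoℚ (w e)) →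
           (∀ {S} → S ∈ subgraphs n → isIsoTo H S ≡ true → length S ≡ k) →
           β μ H *ℚ ℕtoℚ (N ^ k) ≡ ℕtoℚ (∑ (subgraphs n) (λ S → if isIsoTo H S then ∏ S w else 0))
β-scaled {n} {N} {k} μ w H scaled size = sumℚ-scaled (ℕtoℚ (N ^ k)) (subgraphs n) λ {S} S∈ →
  if-scaled (isIsoTo H S) (λ iso → subst (λ k → weight μ S *ℚ ℕtoℚ (N ^ k) ≡ ℕtoℚ (∏ S w)) (size S∈ iso)
    (prodℚ-scaled N S (λ e∈S → scaled (∈sublists⇒⊆ S∈ e∈S))))

module ClearDenominators {n : ℕ} {μ : Fin n → Fin n → ℚ} (prob : IsEdgeProbabilityMeasure μ) (c : ℕ) .{{c≢0 : NonZero c}} where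
  open IsEdgeProbabilityMeasure prob

  den : Fin n × Fin n → ℕ
  den (i , j) = ↧ₙ (μ i j)

  N : ℕ
  N = c * product (map den (edgeList n))

  w : Fin n × Fin n → ℕ
  w (i , j) = ℤ.∣ ↥ (μ i j) ∣ * (N ℕ./ ↧ₙ (μ i j))

  dens≢0 : ∀ (E : List (Fin n × Fin n)) → All NonZero (map den E)
  dens≢0 [] = []
  dens≢0 (_ ∷ E) = _ ∷ dens≢0 E

  c≤N : c ≤ N
  c≤N = m≤m*n c (product (map den (edgeList n))) {{product≢0 (dens≢0 (edgeList n))}}

  N≢0 : NonZero N
  N≢0 = m*n≢0 c _ {{c≢0}} {{product≢0 (dens≢0 (edgeList n))}}

  scaled : ∀ {e} → e ∈ edgeList n → μ (proj₁ e) (proj₂ e) *ℚ ℕtoℚ N ≡ ℕtoℚ (w e)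
  scaled {i , j} e∈ = clear-denominator (μ i j) (nonneg i j (∈edgeList⇒Increasing e∈)) (N ℕ./ ↧ₙ (μ i j))
    (sym (m/n*n≡m (∣n⇒∣m*n c (∈⇒∣product (∈-map⁺ den e∈)))))

  total-w : ∑ (edgeList n) w ≡ N
  total-w = ℕtoℚ-injective (trans (sym (sumℚ-scaled (ℕtoℚ N) (edgeList n) scaled)) (trans (cong (_*ℚ ℕtoℚ N) total) (ℚ.*-identityˡ (ℕtoℚ N))))

-- The cycle on m vertices and the path on m + 1 vertices both have m edges, so the factor N^m turns
-- the left-hand side into the integer form.
rational-bound : ∀ {n l m k d q} (μ : Fin n → Fin n → ℚ) → IsEdgeProbabilityMeasure μ → 2 ≤ l → m ≡ 3 + l → k ≡ 4 + l →
  d ≡ 26947 → q *ℚ ℕtoℚ 10000 ≡ ℕtoℚ d → (ℕtoℚ (2 * m) *ℚ β μ (C m) +ℚ β μ (P k)) *ℚ ℕtoℚ (m ^ (2 + l)) ≤ℚ q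
rational-bound {n} {l} {m} {k} {d} {q} μ prob 2≤l m≡ k≡ d≡ q≡ =
  ℚ.*-cancelʳ-≤-pos (ℕtoℚ (N ^ m * 10000)) {{ℕtoℚ-positive _ {{m*n≢0 _ _ {{m^n≢0 N m {{N≢0}}}}}}}} (begin
    (ℕtoℚ (2 * m) *ℚ β μ (C m) +ℚ β μ (P k)) *ℚ ℕtoℚ M *ℚ ℕtoℚ (N ^ m * 10000)
      ≡⟨ cong ((ℕtoℚ (2 * m) *ℚ β μ (C m) +ℚ β μ (P k)) *ℚ ℕtoℚ M *ℚ_) (ℕtoℚ-* (N ^ m) 10000) ⟩
    (ℕtoℚ (2 * m) *ℚ β μ (C m) +ℚ β μ (P k)) *ℚ ℕtoℚ M *ℚ (ℕtoℚ (N ^ m) *ℚ ℕtoℚ 10000)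
      ≡⟨ rearrange (ℕtoℚ (2 * m)) (β μ (C m)) (β μ (P k)) (ℕtoℚ M) (ℕtoℚ (N ^ m)) (ℕtoℚ 10000) ⟩
    (ℕtoℚ (2 * m) *ℚ (β μ (C m) *ℚ ℕtoℚ (N ^ m)) +ℚ β μ (P k) *ℚ ℕtoℚ (N ^ m)) *ℚ ℕtoℚ M *ℚ ℕtoℚ 10000
      ≡⟨ cong (λ a → a *ℚ ℕtoℚ M *ℚ ℕtoℚ 10000) value≡ ⟩
    ℕtoℚ (value w) *ℚ ℕtoℚ M *ℚ ℕtoℚ 10000
      ≡⟨ trans (ℕtoℚ-* (value w * M) 10000) (cong (_*ℚ ℕtoℚ 10000) (ℕtoℚ-* (value w) M)) ⟨
    ℕtoℚ (value w * M * 10000)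
      ≤⟨ ℕtoℚ-mono (≤-trans (nat-bound w 2≤l (≤-trans c≤N (≤-reflexive (sym total-w))))
           (≤-reflexive (cong₂ (λ N m → d * N ^ m) total-w (sym m≡)))) ⟩
    ℕtoℚ (d * N ^ m)
      ≡⟨ trans (ℕtoℚ-* d (N ^ m)) (cong (_*ℚ ℕtoℚ (N ^ m)) (sym q≡)) ⟩
    q *ℚ ℕtoℚ 10000 *ℚ ℕtoℚ (N ^ m)
      ≡⟨ trans (ℚ.*-assoc q (ℕtoℚ 10000) (ℕtoℚ (N ^ m))) (cong (q *ℚ_) (ℚ.*-comm (ℕtoℚ 10000) (ℕtoℚ (N ^ m)))) ⟩
    q *ℚ (ℕtoℚ (N ^ m) *ℚ ℕtoℚ 10000)
      ≡⟨ cong (q *ℚ_) (ℕtoℚ-* (N ^ m) 10000) ⟨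
    q *ℚ ℕtoℚ (N ^ m * 10000) ∎)
  where
  open ℚ.≤-Reasoning
  instance
    1000m≢0 : NonZero (1000 * m)
    1000m≢0 = subst (λ m → NonZero (1000 * m)) (sym m≡) _
  -- The extra factor 1000 m makes the total so large that the discretisation error costs at most a
  -- factor 1.001.
  open ClearDenominators prob (1000 * m)
  open NatBound n {l} {m} {k} m≡ k≡ {d} d≡
  M = m ^ (2 + l)
  Cs Ps : ℕ
  Cs = ∑ (subgraphs n) (λ S → if isIsoTo (C m) S then ∏ S w else 0)
  Ps = ∑ (subgraphs n) (λ S → if isIsoTo (P k) S then ∏ S w else 0)
  rearrange : ∀ t a b M c x → (t *ℚ a +ℚ b) *ℚ M *ℚ (c *ℚ x) ≡ (t *ℚ (a *ℚ c) +ℚ b *ℚ c) *ℚ M *ℚ x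
  rearrange = solve 6 (λ t a b M c x → (t :* a :+ b) :* M :* (c :* x) := (t :* (a :* c) :+ b :* c) :* M :* x) refl
    where open +-*-Solver
  value≡ : ℕtoℚ (2 * m) *ℚ (β μ (C m) *ℚ ℕtoℚ (N ^ m)) +ℚ β μ (P k) *ℚ ℕtoℚ (N ^ m) ≡ ℕtoℚ (value w)
  value≡ = begin-equality
    ℕtoℚ (2 * m) *ℚ (β μ (C m) *ℚ ℕtoℚ (N ^ m)) +ℚ β μ (P k) *ℚ ℕtoℚ (N ^ m)
      ≡⟨ cong₂ (λ a b → ℕtoℚ (2 * m) *ℚ a +ℚ b)
           (β-scaled μ w (C m) scaled (λ S∈ → length-C S∈ m≡))
           (β-scaled μ w (P k) scaled (λ S∈ iso → trans (length-P S∈ k≡ iso) (sym m≡))) ⟩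
    ℕtoℚ (2 * m) *ℚ ℕtoℚ Cs +ℚ ℕtoℚ Ps
      ≡⟨ trans (ℕtoℚ-+ (2 * m * Cs) Ps) (cong (_+ℚ ℕtoℚ Ps) (ℕtoℚ-* (2 * m) Cs)) ⟨
    ℕtoℚ (2 * m * Cs + Ps)
      ≡⟨ cong ℕtoℚ (∑-coef (λ S → ∏ S w)) ⟨
    ℕtoℚ (value w) ∎

theorem4p7 : (m : ℕ) → 5 ≤ m → (n : ℕ) → (μ : Fin n → Fin n → ℚ) → IsEdgeProbabilityMeasure μ →
    ((ℕtoℚ (2 * m) *ℚ β μ (C m)) +ℚ β μ (P (m + 1))) *ℚ ℕtoℚ (m ^ (m ∸ 1)) ≤ℚ (+ 26947 / 10000)
theorem4p7 m@(suc (suc (suc (suc (suc r))))) (s≤s (s≤s (s≤s (s≤s (s≤s z≤n))))) n μ prob =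
  rational-bound {l = suc (suc r)} μ prob (s≤s (s≤s z≤n)) refl (+-comm m 1) refl refl
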